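{- Let $i\in\{1,2\}$ and let $n$ be a positive integer. Then $$\sum_{\lambda \in \mathcal{N}_i(n)}\delta(\lambda)=\sum_{\lambda \in \mathcal{R}_i(n)}(-1)^{\mathrm{size}(\lambda)}.$$
   Context: A partition of a positive integer $n$ is a non-increasing sequence of positive integers $\lambda=(\lambda_1,\dots,\lambda_r)$ with $\lambda_1+\cdots+\lambda_r=n$; the $\lambda_j$ are its parts, $|\lambda|=n$, and $\mathrm{size}(\lambda)=r$ is its number of parts. For $i\in\{1,2\}$, $\mathcal{N}_i(n)$ (neighborly partitions) is the set of partitions $\lambda$ of $n$ such that: (1) for every part $\lambda_j$ there is an index $l\neq j$ with $|\lambda_l-\lambda_j|\le 1$; (2) every part value occurs at most twice; (3) every part is $\ge 3-i$. For $\lambda\in\mathcal{N}_i(n)$, define the simple graph $G_\lambda$: its vertices are in bijection with the parts of $\lambda$; a part value $h$ of multiplicity $1$ gives one vertex $x_h$, a part value $h$ of multiplicity $2$ gives two vertices $x_h,y_h$. The edges are $\{x_{h+1},x_h\}$ whenever both $x_{h+1},x_h$ are vertices, and $\{x_l,y_l\}$ whenever both $x_l,y_l$ are vertices. The signature is $\delta(\lambda)=\sum_H(-1)^{|E(H)|}$, where $H$ ranges over the subgraphs of $G_\lambda$ with $V(H)=V(G_\lambda)$ and having no isolated vertices (every vertex of $H$ is an endpoint of an edge of $H$). $\mathcal{R}_i(n)$ is the set of partitions of $n$ whose parts are pairwise distinct, all $\ge 3-i$, and all congruent to $0$, $i$ or $-i$ modulo $5$. -}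

module Defs where

open import Data.Nat using (ℕ; zero; suc; _+_; _∸_; _≤_; _≥_; _%_; ∣_-_∣)
open import Data.Nat.Properties using (_≟_; _≤?_)
open import Data.Fin using (Fin)
import Data.Fin.Properties as FinP
open import Data.List using (List; []; _∷_; length; map; filter; concatMap; upTo; lookup; foldr; _++_)
open import Data.Nat.ListAction using (sum)
open import Data.List.Relation.Unary.All using (All)
open import Data.List.Relation.Unary.Any using (Any)
import Data.List.Relation.Unary.All as All
import Data.List.Relation.Unary.Any as Any
open import Data.List.Relation.Unary.Linked using (Linked; linked?)
open import Data.Integer using (ℤ; +_; -_) renaming (_+_ to _+ℤ_)
open import Data.Product using (_×_; _,_; proj₁; proj₂; ∃)
open import Data.Sum using (_⊎_)
open import Relation.Binary.PropositionalEquality using (_≡_; _≢_; refl)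
open import Relation.Nullary using (Dec; yes; no; ¬_)
open import Relation.Nullary.Decidable using (_×-dec_; _⊎-dec_; ¬?)

IsPartition : ℕ → List ℕ → Set
IsPartition n λ′ = Linked (λ a b → b ≤ a) λ′ × All (λ p → 1 ≤ p) λ′ × sum λ′ ≡ n

isPartition? : ∀ n λ′ → Dec (IsPartition n λ′)
isPartition? n λ′ =
  linked? (λ a b → b ≤? a) λ′ ×-dec All.all? (λ p → 1 ≤? p) λ′ ×-dec (sum λ′ ≟ n)

listsOfLength : ℕ → List ℕ → List (List ℕ)
listsOfLength zero    xs = [] ∷ []
listsOfLength (suc k) xs = concatMap (λ x → map (x ∷_) (listsOfLength k xs)) xs

-- every partition of n has at most n parts, each in {1,…,n}; the candidate
-- lists below are pairwise distinct, so this lists each partition exactly once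
partitionsOf : ℕ → List (List ℕ)
partitionsOf n =
  filter (isPartition? n)
    (concatMap (λ k → listsOfLength k (map suc (upTo n))) (upTo (suc n)))

mult : ℕ → List ℕ → ℕ
mult h λ′ = length (filter (_≟ h) λ′)

NeighborCond : List ℕ → Set
NeighborCond λ′ = ∀ (j : Fin (length λ′)) →
  ∃ λ (l : Fin (length λ′)) → l ≢ j × ∣ lookup λ′ l - lookup λ′ j ∣ ≤ 1

MultCond : List ℕ → Set
MultCond λ′ = ∀ (j : Fin (length λ′)) → mult (lookup λ′ j) λ′ ≤ 2

LowerCond : ℕ → List ℕ → Set
LowerCond i λ′ = ∀ (j : Fin (length λ′)) → 3 ∸ i ≤ lookup λ′ j

IsNeighborly : ℕ → List ℕ → Set
IsNeighborly i λ′ = NeighborCond λ′ × MultCond λ′ × LowerCond i λ′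

isNeighborly? : ∀ i λ′ → Dec (IsNeighborly i λ′)
isNeighborly? i λ′ =
  FinP.all? (λ j → FinP.any? (λ l → ¬? (l FinP.≟ j) ×-dec (∣ lookup λ′ l - lookup λ′ j ∣ ≤? 1)))
  ×-dec FinP.all? (λ j → mult (lookup λ′ j) λ′ ≤? 2)
  ×-dec FinP.all? (λ j → 3 ∸ i ≤? lookup λ′ j)

Nset : ℕ → ℕ → List (List ℕ)
Nset i n = filter (isNeighborly? i) (partitionsOf n)

Distinct : List ℕ → Set
Distinct λ′ = ∀ (j l : Fin (length λ′)) → j ≢ l → lookup λ′ j ≢ lookup λ′ l

ModCond : ℕ → List ℕ → Set
ModCond i λ′ = ∀ (j : Fin (length λ′)) →
  (lookup λ′ j % 5 ≡ 0) ⊎ (lookup λ′ j % 5 ≡ i % 5) ⊎ ((lookup λ′ j + i) % 5 ≡ 0)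

IsR : ℕ → List ℕ → Set
IsR i λ′ = Distinct λ′ × LowerCond i λ′ × ModCond i λ′

isR? : ∀ i λ′ → Dec (IsR i λ′)
isR? i λ′ =
  FinP.all? (λ j → FinP.all? (λ l → ¬? (j FinP.≟ l) →-dec′ ¬? (lookup λ′ j ≟ lookup λ′ l)))
  ×-dec FinP.all? (λ j → 3 ∸ i ≤? lookup λ′ j)
  ×-dec FinP.all? (λ j → (lookup λ′ j % 5 ≟ 0) ⊎-dec (lookup λ′ j % 5 ≟ i % 5) ⊎-dec ((lookup λ′ j + i) % 5 ≟ 0))
  where
  open import Relation.Nullary.Decidable using () renaming (_→-dec_ to _→-dec′_)

Rset : ℕ → ℕ → List (List ℕ)
Rset i n = filter (isR? i) (partitionsOf n)

data Tag : Set where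
  X Y : Tag

Vertex : Set
Vertex = ℕ × Tag       -- (h , X) is x_h,  (h , Y) is y_h

Edge : Set
Edge = Vertex × Vertex

_≟T_ : (a b : Tag) → Dec (a ≡ b)
X ≟T X = yes refl
X ≟T Y = no λ ()
Y ≟T X = no λ ()
Y ≟T Y = yes refl

_≟V_ : (u v : Vertex) → Dec (u ≡ v)
(h , s) ≟V (k , t) with h ≟ k | s ≟T t
... | yes refl | yes refl = yes refl
... | no h≢k   | _        = no λ { refl → h≢k refl }
... | yes _    | no s≢t   = no λ { refl → s≢t refl }

-- the part values that may occur: 1, …, |λ| (every part is ≤ sum)
values : List ℕ → List ℕ
values λ′ = map suc (upTo (sum λ′))

vertices : List ℕ → List Vertex
vertices λ′ = concatMap vs (values λ′)
  where
  vs : ℕ → List Vertex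
  vs h with 1 ≤? mult h λ′ | 2 ≤? mult h λ′
  ... | yes _ | yes _ = (h , X) ∷ (h , Y) ∷ []
  ... | yes _ | no _  = (h , X) ∷ []
  ... | no _  | _     = []

edges : List ℕ → List Edge
edges λ′ = concatMap es (values λ′)
  where
  e1 : ℕ → List Edge
  e1 h with 1 ≤? mult (suc h) λ′ | 1 ≤? mult h λ′
  ... | yes _ | yes _ = ((suc h , X) , (h , X)) ∷ []
  ... | _     | _     = []
  e2 : ℕ → List Edge
  e2 h with 2 ≤? mult h λ′
  ... | yes _ = ((h , X) , (h , Y)) ∷ []
  ... | no _  = []
  es : ℕ → List Edge
  es h = e1 h ++ e2 h

-- all sub-lists (subsets, as the edges are pairwise distinct)
subsets : {A : Set} → List A → List (List A)
subsets []       = [] ∷ []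
subsets (x ∷ xs) = subsets xs ++ map (x ∷_) (subsets xs)

-- spanning subgraph with edge set S has no isolated vertex
Covers : List Edge → List Vertex → Set
Covers S V = All (λ v → Any (λ e → proj₁ e ≡ v ⊎ proj₂ e ≡ v) S) V

covers? : ∀ S V → Dec (Covers S V)
covers? S V = All.all? (λ v → Any.any? (λ e → (proj₁ e ≟V v) ⊎-dec (proj₂ e ≟V v)) S) V

negOnePow : ℕ → ℤ
negOnePow zero    = + 1
negOnePow (suc k) = - negOnePow k

sumℤ : List ℤ → ℤ
sumℤ = foldr _+ℤ_ (+ 0)

δ : List ℕ → ℤ
δ λ′ = sumℤ (map (λ S → negOnePow (length S))
                 (filter (λ S → covers? S (vertices λ′)) (subsets (edges λ′))))

size : List ℕ → ℕ
size = length

{-# OPTIONS --safe #-}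

-- Let F_h be the generating function of δ over partitions with parts ≥ h. Peeling the edges at
-- the smallest part value off the graph gives F_h = (1 − q^h)(F_(h+1) + q^h (1 − q^(h+1)) F_(h+2)),
-- so (1 − q) ⋯ (1 − q^k) F_(k+1) satisfies M_k = M_(k+1) + q^(k+1) M_(k+2). The Rogers–Selberg series
--   M_k = Σ_m (−1)^m q^(2km + m(5m−1)/2) (1 − q^(2m+k)) (1 − q^(m+1)) ⋯ (1 − q^(m+k−1))
-- solves this recurrence by telescoping, and the solution is determined by its behaviour as k → ∞.
-- At k = 0 and k = 1 it is a theta series, which Jacobi's triple product (in Cauchy's finite form)
-- turns into the product of the factors 1 − q^v over the parts v admitted in R_i.
-- All of this takes place in power series modulo q^(n+1), where only finite sums and products occur.

module Submission where

open import Defs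
open import Level using (0ℓ)
open import Algebra.Bundles using (CommutativeRing)
open import Algebra.Solver.Ring.AlmostCommutativeRing using (_-Raw-AlmostCommutative⟶_; fromCommutativeRing)
open import Data.Bool using (Bool; true; false; if_then_else_)
open import Data.Empty using (⊥-elim)
import Data.Fin.Properties as Fin
import Data.Integer as ℤ
open import Data.Integer using (ℤ; +_; -[1+_])
import Data.Integer.Properties as ℤₚ
open import Data.List using (List; []; _∷_; _++_; map; filter; concatMap; upTo; applyUpTo; length; replicate; lookup)
open import Data.List.Membership.Propositional using (_∈_; find; lose)
open import Data.List.Membership.Propositional.Properties using (∈-map⁺; ∈-map⁻; ∈-concatMap⁺; ∈-concatMap⁻; ∈-filter⁺; ∈-filter⁻; ∈-upTo⁺; ∈-length; ∈-lookup)
open import Data.List.Membership.Propositional.Properties.WithK using (unique∧set⇒bag)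
import Data.List.Properties as List
open import Data.List.Relation.Binary.BagAndSetEquality using (∼bag⇒↭)
open import Data.List.Relation.Binary.Permutation.Propositional using (_↭_; ↭⇒↭ₛ)
import Data.List.Relation.Binary.Permutation.Propositional.Properties as Perm
open import Data.List.Relation.Binary.Permutation.Setoid.Properties using (foldr-commMonoid)
import Data.List.Relation.Unary.All as All
import Data.List.Relation.Unary.All.Properties as All
import Data.List.Relation.Unary.AllPairs as AllPairs
import Data.List.Relation.Unary.AllPairs.Properties as AllPairs
import Data.List.Relation.Unary.Any as Any
import Data.List.Relation.Unary.Any.Properties as Any
open import Data.List.Relation.Unary.Linked.Properties using (Linked⇒AllPairs; AllPairs⇒Linked)
open import Data.List.Relation.Unary.Unique.Propositional using (Unique)
import Data.List.Relation.Unary.Unique.Propositional.Properties as Unique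
open import Data.Maybe using (Maybe; just; nothing)
open import Data.Nat as ℕ using (ℕ; zero; suc; z≤n; s≤s; _≤_; _<_; _≤?_; _∸_; _%_; ∣_-_∣)
open import Data.Nat.DivMod using ([m+kn]%n≡m%n)
open import Data.Nat.ListAction using (sum)
open import Data.Nat.ListAction.Properties using (sum-++)
import Data.Nat.Properties as ℕₚ
open import Data.Nat.Solver using () renaming (module +-*-Solver to ℕ-Solver)
open import Data.Product using (_,_; _×_; proj₁; proj₂; ∃)
open import Data.Sum using (_⊎_; inj₁; inj₂)
open import Function using (_∘_; id; flip; mk⇔)
import Relation.Binary.PropositionalEquality as ≡
open ≡ using (_≡_; _≢_)
open import Relation.Nullary using (yes; no; ¬_; Dec; does)
open import Relation.Nullary.Decidable using (_×-dec_; _⊎-dec_; dec-true; dec-false)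
open import Relation.Unary using (Decidable)

-- The neighborly condition never enters a generating function. A part without a neighbor is an
-- isolated vertex, so `δ` vanishes there by itself; condition (2) is the choice of each
-- multiplicity from 0, 1, 2, and condition (3) fixes the first part value. The sum of `δ` can
-- therefore run over all multiplicity lists, where a linear transfer from one part value to the
-- next applies. It has two states, because the lowest vertex may or may not be covered already by
-- an edge from below. Eliminating the second state (`A-B`) is what makes the recurrence for F_h
-- reach two steps up. The other constraint is that quotients are avoided. Gaussian binomials are
-- carried with their denominators cleared, and the Rogers-Selberg terms are written as sums of two
-- products. The only factor ever cancelled is 1 - q: for i = 1 the series M_1 equals (1 - q) F_2,
-- and the triple product contains the same factor for the excluded part 1.

module PowerSeries where

  open ≡
  open import Data.Integer using (_+_; _*_; -_)
  open import Data.Integer.Solver using (module +-*-Solver)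

  -- Integer power series and the ring they form modulo q^(n+1).

  Series : Set
  Series = ℕ → ℤ

  constant : ℤ → Series
  constant c zero    = c
  constant c (suc _) = + 0

  monomial : ℤ → ℕ → Series
  monomial c zero    = constant c
  monomial c (suc m) zero    = + 0
  monomial c (suc m) (suc k) = monomial c m k

  _⊕_ _⊛_ : Series → Series → Series
  (f ⊕ g) k = f k + g k
  (f ⊛ g) zero    = f 0 * g 0
  (f ⊛ g) (suc k) = f 0 * g (suc k) + ((f ∘ suc) ⊛ g) k

  ⊖_ : Series → Series
  (⊖ f) k = - f k

  -- `⊛` peels the constant term off its left factor only. Peeling it off the right factor gives the
  -- mirror image of that recursion, which the induction for commutativity needs.
  ⊛-sucʳ : ∀ f g k → (f ⊛ g) (suc k) ≡ (f ⊛ (g ∘ suc)) k + f (suc k) * g 0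
  ⊛-sucʳ f g zero    = refl
  ⊛-sucʳ f g (suc k) = begin
    f 0 * g (2 ℕ.+ k) + ((f ∘ suc) ⊛ g) (suc k)
      ≡⟨ cong (_+_ (f 0 * g (2 ℕ.+ k))) (⊛-sucʳ (f ∘ suc) g k) ⟩
    f 0 * g (2 ℕ.+ k) + (((f ∘ suc) ⊛ (g ∘ suc)) k + f (2 ℕ.+ k) * g 0)
      ≡⟨ ℤₚ.+-assoc (f 0 * g (2 ℕ.+ k)) _ _ ⟨
    f 0 * g (2 ℕ.+ k) + ((f ∘ suc) ⊛ (g ∘ suc)) k + f (2 ℕ.+ k) * g 0 ∎
    where open ≡-Reasoning

  ⊛-comm : ∀ f g k → (f ⊛ g) k ≡ (g ⊛ f) k
  ⊛-comm f g zero    = ℤₚ.*-comm (f 0) (g 0)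
  ⊛-comm f g (suc k) = begin
    f 0 * g (suc k) + ((f ∘ suc) ⊛ g) k ≡⟨ cong₂ _+_ (ℤₚ.*-comm (f 0) _) (⊛-comm (f ∘ suc) g k) ⟩
    g (suc k) * f 0 + (g ⊛ (f ∘ suc)) k ≡⟨ ℤₚ.+-comm (g (suc k) * f 0) _ ⟩
    (g ⊛ (f ∘ suc)) k + g (suc k) * f 0 ≡⟨ ⊛-sucʳ g f k ⟨
    (g ⊛ f) (suc k) ∎
    where open ≡-Reasoning

  ⊛-distribʳ : ∀ h f g k → ((f ⊕ g) ⊛ h) k ≡ (f ⊛ h) k + (g ⊛ h) k
  ⊛-distribʳ h f g zero    = ℤₚ.*-distribʳ-+ (h 0) (f 0) (g 0)
  ⊛-distribʳ h f g (suc k) = begin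
    (f 0 + g 0) * h (suc k) + (((f ∘ suc) ⊕ (g ∘ suc)) ⊛ h) k
      ≡⟨ cong (_+_ ((f 0 + g 0) * h (suc k))) (⊛-distribʳ h (f ∘ suc) (g ∘ suc) k) ⟩
    (f 0 + g 0) * h (suc k) + (((f ∘ suc) ⊛ h) k + ((g ∘ suc) ⊛ h) k)
      ≡⟨ solve 5 (λ a b c d e → (a :+ b) :* c :+ (d :+ e) := (a :* c :+ d) :+ (b :* c :+ e))
           refl (f 0) (g 0) (h (suc k)) (((f ∘ suc) ⊛ h) k) (((g ∘ suc) ⊛ h) k) ⟩
    (f ⊛ h) (suc k) + (g ⊛ h) (suc k) ∎
    where open ≡-Reasoning
          open +-*-Solver

  ⊛-scaleˡ : ∀ c f g k → ((λ j → c * f j) ⊛ g) k ≡ c * (f ⊛ g) k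
  ⊛-scaleˡ c f g zero    = ℤₚ.*-assoc c (f 0) (g 0)
  ⊛-scaleˡ c f g (suc k) = begin
    c * f 0 * g (suc k) + ((λ j → c * f (suc j)) ⊛ g) k
      ≡⟨ cong₂ _+_ (ℤₚ.*-assoc c (f 0) (g (suc k))) (⊛-scaleˡ c (f ∘ suc) g k) ⟩
    c * (f 0 * g (suc k)) + c * ((f ∘ suc) ⊛ g) k
      ≡⟨ ℤₚ.*-distribˡ-+ c (f 0 * g (suc k)) _ ⟨
    c * (f ⊛ g) (suc k) ∎
    where open ≡-Reasoning

  ⊛-assoc : ∀ f g h k → ((f ⊛ g) ⊛ h) k ≡ (f ⊛ (g ⊛ h)) k
  ⊛-assoc f g h zero    = ℤₚ.*-assoc (f 0) (g 0) (h 0)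
  ⊛-assoc f g h (suc k) = begin
    f 0 * g 0 * h (suc k) + (((λ j → f 0 * g (suc j)) ⊕ ((f ∘ suc) ⊛ g)) ⊛ h) k
      ≡⟨ cong (_+_ (f 0 * g 0 * h (suc k))) (begin
           (((λ j → f 0 * g (suc j)) ⊕ ((f ∘ suc) ⊛ g)) ⊛ h) k
             ≡⟨ ⊛-distribʳ h (λ j → f 0 * g (suc j)) ((f ∘ suc) ⊛ g) k ⟩
           ((λ j → f 0 * g (suc j)) ⊛ h) k + (((f ∘ suc) ⊛ g) ⊛ h) k
             ≡⟨ cong₂ _+_ (⊛-scaleˡ (f 0) (g ∘ suc) h k) (⊛-assoc (f ∘ suc) g h k) ⟩
           f 0 * ((g ∘ suc) ⊛ h) k + ((f ∘ suc) ⊛ (g ⊛ h)) k ∎) ⟩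
    f 0 * g 0 * h (suc k) + (f 0 * ((g ∘ suc) ⊛ h) k + ((f ∘ suc) ⊛ (g ⊛ h)) k)
      ≡⟨ solve 5 (λ a b c d e → a :* b :* c :+ (a :* d :+ e) := a :* (b :* c :+ d) :+ e)
           refl (f 0) (g 0) (h (suc k)) (((g ∘ suc) ⊛ h) k) (((f ∘ suc) ⊛ (g ⊛ h)) k) ⟩
    (f ⊛ (g ⊛ h)) (suc k) ∎
    where open ≡-Reasoning
          open +-*-Solver

  constant0 : ∀ k → constant (+ 0) k ≡ + 0
  constant0 zero    = refl
  constant0 (suc k) = refl

  -- A coefficient of a product depends only on coefficients of at most the same index, so agreement
  -- up to n is a congruence; this is what makes `truncated` a ring.
  ⊛-cong : ∀ n {f f′ g g′} → (∀ k → k ℕ.≤ n → f k ≡ f′ k) → (∀ k → k ℕ.≤ n → g k ≡ g′ k) →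
           ∀ k → k ℕ.≤ n → (f ⊛ g) k ≡ (f′ ⊛ g′) k
  ⊛-cong n p q zero    k≤n = cong₂ _*_ (p 0 z≤n) (q 0 z≤n)
  ⊛-cong (suc n) p q (suc k) (s≤s k≤n) =
    cong₂ _+_ (cong₂ _*_ (p 0 z≤n) (q (suc k) (s≤s k≤n)))
              (⊛-cong n (λ j j≤n → p (suc j) (s≤s j≤n)) (λ j j≤n → q j (ℕₚ.m≤n⇒m≤1+n j≤n)) k k≤n)

  constant-⊛ : ∀ c g k → (constant c ⊛ g) k ≡ c * g k
  constant-⊛ c g zero    = refl
  constant-⊛ c g (suc k) = begin
    c * g (suc k) + ((λ _ → + 0) ⊛ g) k ≡⟨ cong (_+_ (c * g (suc k))) (zero-⊛ k) ⟩
    c * g (suc k) + + 0 ≡⟨ ℤₚ.+-identityʳ _ ⟩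
    c * g (suc k) ∎
    where
    open ≡-Reasoning
    zero-⊛ : ∀ k → ((λ _ → + 0) ⊛ g) k ≡ + 0
    zero-⊛ zero    = refl
    zero-⊛ (suc k) = trans (ℤₚ.+-identityˡ _) (zero-⊛ k)

  shift-⊛ : ∀ f g k → f 0 ≡ + 0 → (f ⊛ g) (suc k) ≡ ((f ∘ suc) ⊛ g) k
  shift-⊛ f g k f0 rewrite f0 = ℤₚ.+-identityˡ _

  monomial-⊛ : ∀ a l c m k → (monomial a l ⊛ monomial c m) k ≡ monomial (a * c) (l ℕ.+ m) k
  monomial-⊛ a zero c zero    k = trans (constant-⊛ a (constant c) k) (lemma k)
    where lemma : ∀ k → a * constant c k ≡ constant (a * c) k
          lemma zero    = refl
          lemma (suc k) = ℤₚ.*-zeroʳ a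
  monomial-⊛ a zero c (suc m) zero    = ℤₚ.*-zeroʳ a
  monomial-⊛ a zero c (suc m) (suc k) = begin
    (constant a ⊛ monomial c (suc m)) (suc k) ≡⟨ constant-⊛ a (monomial c (suc m)) (suc k) ⟩
    a * monomial c m k                        ≡⟨ constant-⊛ a (monomial c m) k ⟨
    (constant a ⊛ monomial c m) k             ≡⟨ monomial-⊛ a zero c m k ⟩
    monomial (a * c) m k ∎
    where open ≡-Reasoning
  monomial-⊛ a (suc l) c m zero    = refl
  monomial-⊛ a (suc l) c m (suc k) =
    trans (shift-⊛ (monomial a (suc l)) (monomial c m) k refl) (monomial-⊛ a l c m k)

  -- Equality modulo q^(n+1).
  record Eq (n : ℕ) (f g : Series) : Set where
    constructor mkEq
    field coeff : ∀ k → k ℕ.≤ n → f k ≡ g k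
  open Eq public

  -- The quotient is taken by coarsening equality, not by cutting off the series. Coefficient n is
  -- still read off by application, and q^(n+1) becomes 0 although no operation changes.
  truncated : ℕ → CommutativeRing 0ℓ 0ℓ
  truncated n = record
    { Carrier = Series
    ; _≈_ = Eq n
    ; _+_ = _⊕_
    ; _*_ = _⊛_
    ; -_ = ⊖_
    ; 0# = constant (+ 0)
    ; 1# = constant (+ 1)
    ; isCommutativeRing = record
      { isRing = record
        { +-isAbelianGroup = record
          { isGroup = record
            { isMonoid = record
              { isSemigroup = record
                { isMagma = record
                  { isEquivalence = record
                    { refl = mkEq λ _ _ → refl
                    ; sym = λ (mkEq p) → mkEq λ k k≤n → sym (p k k≤n)
                    ; trans = λ (mkEq p) (mkEq q) → mkEq λ k k≤n → trans (p k k≤n) (q k k≤n)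
                    }
                  ; ∙-cong = λ (mkEq p) (mkEq q) → mkEq λ k k≤n → cong₂ _+_ (p k k≤n) (q k k≤n)
                  }
                ; assoc = λ f g h → mkEq λ k _ → ℤₚ.+-assoc (f k) (g k) (h k)
                }
              ; identity = 0-identityˡ
                         , λ f → mkEq λ k _ → trans (cong (_+_ (f k)) (constant0 k)) (ℤₚ.+-identityʳ (f k))
              }
            ; inverse = (λ f → mkEq λ k _ → trans (ℤₚ.+-inverseˡ (f k)) (sym (constant0 k)))
                      , (λ f → mkEq λ k _ → trans (ℤₚ.+-inverseʳ (f k)) (sym (constant0 k)))
            ; ⁻¹-cong = λ (mkEq p) → mkEq λ k k≤n → cong -_ (p k k≤n)
            }
          ; comm = λ f g → mkEq λ k _ → ℤₚ.+-comm (f k) (g k)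
          }
        ; *-cong = λ (mkEq p) (mkEq q) → mkEq (⊛-cong n p q)
        ; *-assoc = λ f g h → mkEq λ k _ → ⊛-assoc f g h k
        ; *-identity = (λ f → mkEq λ k _ → 1-identityˡ f k)
                     , (λ f → mkEq λ k _ → trans (⊛-comm f (constant (+ 1)) k) (1-identityˡ f k))
        ; distrib = (λ h f g → mkEq λ k _ → trans (⊛-comm h (f ⊕ g) k) (trans (⊛-distribʳ h f g k)
                                         (cong₂ _+_ (⊛-comm f h k) (⊛-comm g h k))))
                  , (λ h f g → mkEq λ k _ → ⊛-distribʳ h f g k)
        }
      ; *-comm = λ f g → mkEq λ k _ → ⊛-comm f g k
      }
    }
    where
    0-identityˡ : ∀ f → Eq n (constant (+ 0) ⊕ f) f
    0-identityˡ f = mkEq λ k _ → trans (cong (_+ f k) (constant0 k)) (ℤₚ.+-identityˡ (f k))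
    1-identityˡ : ∀ f k → (constant (+ 1) ⊛ f) k ≡ f k
    1-identityˡ f k = trans (constant-⊛ (+ 1) f k) (ℤₚ.*-identityˡ (f k))

  scalars : ∀ n → CommutativeRing.rawRing ℤₚ.+-*-commutativeRing
                    -Raw-AlmostCommutative⟶ fromCommutativeRing (truncated n)
  scalars n = record
    { ⟦_⟧ = constant
    ; +-homo = λ a b → mkEq λ { zero _ → refl ; (suc k) _ → refl }
    ; *-homo = λ a b → mkEq λ k _ → sym (monomial-⊛ a 0 b 0 k)
    ; -‿homo = λ a → mkEq λ { zero _ → refl ; (suc k) _ → refl }
    ; 0-homo = mkEq λ _ _ → refl
    ; 1-homo = mkEq λ _ _ → refl
    }

-- Partitions encoded by the multiplicities of their part values.

module Partitions where

  open ≡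
  open import Data.List.Relation.Unary.All using (All; []; _∷_)
  open import Data.List.Relation.Unary.AllPairs using (AllPairs; []; _∷_)
  open import Data.List.Relation.Unary.Any using (here; there)
  open import Data.Integer using () renaming (_+_ to _+ℤ_)

  concatMap-unique : {A B : Set} {f : A → List B} {xs : List A} → Unique xs → (∀ x → Unique (f x)) →
                     (∀ {x y z} → z ∈ f x → z ∈ f y → x ≡ y) → Unique (concatMap f xs)
  concatMap-unique {f = f} {xs} xs! f! f-disjoint = Unique.concat⁺ (All.map⁺ (All.universal f! xs))
    (AllPairs.map⁺ (AllPairs.map (λ { x≢y {_} (z∈fx , z∈fy) → x≢y (f-disjoint z∈fx z∈fy) }) xs!))

  ∈-listsOfLength⁺ : ∀ {xs l} → All (_∈ xs) l → l ∈ listsOfLength (length l) xs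
  ∈-listsOfLength⁺ {xs} []            = here refl
  ∈-listsOfLength⁺ {xs} {x ∷ l} (x∈xs ∷ l⊆xs) =
    ∈-concatMap⁺ _ {xs = xs} (lose x∈xs (∈-map⁺ (x ∷_) (∈-listsOfLength⁺ l⊆xs)))

  ∈-listsOfLength⁻ : ∀ k {xs l} → l ∈ listsOfLength k xs → All (_∈ xs) l × length l ≡ k
  ∈-listsOfLength⁻ zero    (here refl) = [] , refl
  ∈-listsOfLength⁻ (suc k) {xs} l∈ with find (∈-concatMap⁻ _ {xs = xs} l∈)
  ... | x , x∈xs , l∈′ with ∈-map⁻ (x ∷_) l∈′
  ... | l , l∈″ , refl = let l⊆xs , len = ∈-listsOfLength⁻ k l∈″ in x∈xs ∷ l⊆xs , cong suc len

  listsOfLength-unique : ∀ k {xs} → Unique xs → Unique (listsOfLength k xs)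
  listsOfLength-unique zero    xs! = [] ∷ []
  listsOfLength-unique (suc k) xs! =
    concatMap-unique xs! (λ x → Unique.map⁺ List.∷-injectiveʳ (listsOfLength-unique k xs!))
      λ z∈x z∈y → let _ , _ , z≡x = ∈-map⁻ _ z∈x
                      _ , _ , z≡y = ∈-map⁻ _ z∈y
                  in List.∷-injectiveˡ (trans (sym z≡x) z≡y)

  partitionsOf-unique : ∀ n → Unique (partitionsOf n)
  partitionsOf-unique n = Unique.filter⁺ (isPartition? n)
    (concatMap-unique (Unique.upTo⁺ (suc n))
      (λ k → listsOfLength-unique k (Unique.map⁺ ℕₚ.suc-injective (Unique.upTo⁺ n)))
      λ {k} {l} z∈k z∈l → trans (sym (proj₂ (∈-listsOfLength⁻ k z∈k))) (proj₂ (∈-listsOfLength⁻ l z∈l)))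

  length≤sum : ∀ {l} → All (1 ≤_) l → length l ≤ sum l
  length≤sum []         = z≤n
  length≤sum (1≤x ∷ 1≤l) = ℕₚ.+-mono-≤ 1≤x (length≤sum 1≤l)

  parts≤sum : ∀ l → All (_≤ sum l) l
  parts≤sum []      = []
  parts≤sum (x ∷ l) = ℕₚ.m≤m+n x (sum l) ∷ All.map (λ y≤ → ℕₚ.≤-trans y≤ (ℕₚ.m≤n+m (sum l) x)) (parts≤sum l)

  ∈-partitionsOf⁺ : ∀ {n l} → IsPartition n l → l ∈ partitionsOf n
  ∈-partitionsOf⁺ {n} {l} isP@(_ , pos , refl) = ∈-filter⁺ (isPartition? n)
    (∈-concatMap⁺ (λ k → listsOfLength k (map suc (upTo n))) {xs = upTo (suc n)} (lose (∈-upTo⁺ (s≤s (length≤sum pos)))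
      (∈-listsOfLength⁺ (All.map (λ { (s≤s _ , x≤n) → ∈-map⁺ suc (∈-upTo⁺ x≤n) }) (All.zip (pos , parts≤sum l))))))
    isP

  ∈-partitionsOf⁻ : ∀ {n l} → l ∈ partitionsOf n → IsPartition n l
  ∈-partitionsOf⁻ {n} l∈ = proj₂ (∈-filter⁻ (isPartition? n)
    {xs = concatMap (λ k → listsOfLength k (map suc (upTo n))) (upTo (suc n))} l∈)

  mult-++ : ∀ v l l′ → mult v (l ++ l′) ≡ mult v l ℕ.+ mult v l′
  mult-++ v l l′ = trans (cong length (List.filter-++ (ℕₚ._≟ v) l l′)) (List.length-++ (filter (ℕₚ._≟ v) l))

  mult-same : ∀ v l → mult v (v ∷ l) ≡ suc (mult v l)
  mult-same v l = cong length (List.filter-accept (ℕₚ._≟ v) refl)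

  mult-other : ∀ {v x} l → x ≢ v → mult v (x ∷ l) ≡ mult v l
  mult-other {v} l x≢v = cong length (List.filter-reject (ℕₚ._≟ v) x≢v)

  mult-absent : ∀ {v l} → All (_≢ v) l → mult v l ≡ 0
  mult-absent {v} l≢v = cong length (List.filter-none (ℕₚ._≟ v) l≢v)

  mult-constant : ∀ {v l} → All (_≡ v) l → mult v l ≡ length l
  mult-constant {v} l≡v = cong length (List.filter-all (ℕₚ._≟ v) l≡v)

  -- The partition in which the parts h, h + 1, … have multiplicities c₀, c₁, …
  toParts : ℕ → List ℕ → List ℕ
  toParts h []       = []
  toParts h (c ∷ cs) = toParts (suc h) cs ++ replicate c h

  toParts-≥ : ∀ h cs → All (h ≤_) (toParts h cs)
  toParts-≥ h []       = []
  toParts-≥ h (c ∷ cs) =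
    All.++⁺ (All.map ℕₚ.<⇒≤ (toParts-≥ (suc h) cs)) (All.replicate⁺ c ℕₚ.≤-refl)

  toParts-descending : ∀ h cs → AllPairs (λ a b → b ≤ a) (toParts h cs)
  toParts-descending h []       = []
  toParts-descending h (c ∷ cs) = AllPairs.++⁺ (toParts-descending (suc h) cs) (constant c)
    (All.map (λ h<x → All.replicate⁺ c (ℕₚ.<⇒≤ h<x)) (toParts-≥ (suc h) cs))
    where
    constant : ∀ c → AllPairs (λ a b → b ≤ a) (replicate c h)
    constant zero    = []
    constant (suc c) = All.replicate⁺ c ℕₚ.≤-refl ∷ constant c

  sum-toParts : ∀ h c cs → sum (toParts h (c ∷ cs)) ≡ sum (toParts (suc h) cs) ℕ.+ c ℕ.* h
  sum-toParts h c cs = trans (sum-++ (toParts (suc h) cs) (replicate c h)) (cong (ℕ._+_ (sum (toParts (suc h) cs))) (sum-replicate c))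
    where
    sum-replicate : ∀ c → sum (replicate c h) ≡ c ℕ.* h
    sum-replicate zero    = refl
    sum-replicate (suc c) = cong (ℕ._+_ h) (sum-replicate c)

  mult-toParts-here : ∀ h c cs → mult h (toParts h (c ∷ cs)) ≡ c
  mult-toParts-here h c cs = begin
    mult h (toParts (suc h) cs ++ replicate c h)          ≡⟨ mult-++ h (toParts (suc h) cs) _ ⟩
    mult h (toParts (suc h) cs) ℕ.+ mult h (replicate c h)  ≡⟨ cong₂ ℕ._+_ (mult-absent (All.map ℕₚ.>⇒≢ (toParts-≥ (suc h) cs)))
                                                                       (mult-constant (All.replicate⁺ c refl)) ⟩
    length (replicate c h)                                ≡⟨ List.length-replicate c ⟩
    c                                                     ∎
    where open ≡-Reasoning

  mult-toParts-≢ : ∀ {h v} c cs → v ≢ h → mult v (toParts h (c ∷ cs)) ≡ mult v (toParts (suc h) cs)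
  mult-toParts-≢ {h} {v} c cs v≢h = begin
    mult v (toParts (suc h) cs ++ replicate c h)          ≡⟨ mult-++ v (toParts (suc h) cs) _ ⟩
    mult v (toParts (suc h) cs) ℕ.+ mult v (replicate c h) ≡⟨ cong (mult v (toParts (suc h) cs) ℕ.+_) (mult-absent (All.replicate⁺ c (v≢h ∘ sym))) ⟩
    mult v (toParts (suc h) cs) ℕ.+ 0                     ≡⟨ ℕₚ.+-identityʳ _ ⟩
    mult v (toParts (suc h) cs)                           ∎
    where open ≡-Reasoning

  -- Trailing zeros leave no trace in the partition, hence the condition on the lengths. Given it,
  -- the head is recovered as the multiplicity of h, and the common block of copies of h cancels.
  toParts-injective : ∀ h cs cs′ → length cs ≡ length cs′ → toParts h cs ≡ toParts h cs′ → cs ≡ cs′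
  toParts-injective h []       []         _   _ = refl
  toParts-injective h (c ∷ cs) (c′ ∷ cs′) len e
    with trans (sym (mult-toParts-here h c cs)) (trans (cong (mult h) e) (mult-toParts-here h c′ cs′))
  ... | refl = cong (c ∷_) (toParts-injective (suc h) cs cs′ (ℕₚ.suc-injective len)
                 (List.++-cancelʳ (replicate c h) (toParts (suc h) cs) (toParts (suc h) cs′) e))

  multsFrom : ℕ → ℕ → List ℕ → List ℕ
  multsFrom h zero    l = []
  multsFrom h (suc k) l = mult h l ∷ multsFrom (suc h) k l

  length-multsFrom : ∀ h k l → length (multsFrom h k l) ≡ k
  length-multsFrom h zero    l = refl
  length-multsFrom h (suc k) l = cong suc (length-multsFrom (suc h) k l)

  multsFrom-cong : ∀ h k {l l′} → (∀ v → h ≤ v → mult v l ≡ mult v l′) → multsFrom h k l ≡ multsFrom h k l′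
  multsFrom-cong h zero    e = refl
  multsFrom-cong h (suc k) e = cong₂ _∷_ (e h ℕₚ.≤-refl) (multsFrom-cong (suc h) k λ v h<v → e v (ℕₚ.<⇒≤ h<v))

  mult-filter : ∀ {h v} l → h < v → mult v (filter (h ℕₚ.<?_) l) ≡ mult v l
  mult-filter []      h<v = refl
  mult-filter {h} {v} (x ∷ l) h<v with h ℕₚ.<? x | x ℕₚ.≟ v
  ... | yes h<x | yes refl = begin
    mult v (filter (h ℕₚ.<?_) (v ∷ l)) ≡⟨ cong (mult v) (List.filter-accept (h ℕₚ.<?_) h<x) ⟩
    mult v (v ∷ filter (h ℕₚ.<?_) l)   ≡⟨ mult-same v _ ⟩
    suc (mult v (filter (h ℕₚ.<?_) l)) ≡⟨ cong suc (mult-filter l h<v) ⟩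
    suc (mult v l)                     ≡⟨ mult-same v l ⟨
    mult v (v ∷ l)                     ∎
    where open ≡-Reasoning
  ... | yes h<x | no x≢v = begin
    mult v (filter (h ℕₚ.<?_) (x ∷ l)) ≡⟨ cong (mult v) (List.filter-accept (h ℕₚ.<?_) h<x) ⟩
    mult v (x ∷ filter (h ℕₚ.<?_) l)   ≡⟨ mult-other _ x≢v ⟩
    mult v (filter (h ℕₚ.<?_) l)       ≡⟨ mult-filter l h<v ⟩
    mult v l                           ≡⟨ mult-other l x≢v ⟨
    mult v (x ∷ l)                     ∎
    where open ≡-Reasoning
  ... | no h≮x  | yes refl = ⊥-elim (h≮x h<v)
  ... | no h≮x  | no x≢v = begin
    mult v (filter (h ℕₚ.<?_) (x ∷ l)) ≡⟨ cong (mult v) (List.filter-reject (h ℕₚ.<?_) h≮x) ⟩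
    mult v (filter (h ℕₚ.<?_) l)       ≡⟨ mult-filter l h<v ⟩
    mult v l                           ≡⟨ mult-other l x≢v ⟨
    mult v (x ∷ l)                     ∎
    where open ≡-Reasoning

  all≡⇒replicate : ∀ {h : ℕ} {l} → All (_≡ h) l → l ≡ replicate (length l) h
  all≡⇒replicate []            = refl
  all≡⇒replicate (refl ∷ l≡h) = cong (_ ∷_) (all≡⇒replicate l≡h)

  split-smallest : ∀ {h l} → AllPairs (λ a b → b ≤ a) l → All (h ≤_) l →
                   l ≡ filter (h ℕₚ.<?_) l ++ replicate (mult h l) h
  split-smallest []               []          = refl
  split-smallest {h} {x ∷ l} (x≥l ∷ desc) (h≤x ∷ h≤l) with h ℕₚ.≟ x
  ... | no h≢x = begin
    x ∷ l
      ≡⟨ cong (x ∷_) (split-smallest desc h≤l) ⟩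
    x ∷ filter (h ℕₚ.<?_) l ++ replicate (mult h l) h
      ≡⟨ cong₂ (λ l′ c → l′ ++ replicate c h) (List.filter-accept (h ℕₚ.<?_) (ℕₚ.≤∧≢⇒< h≤x h≢x)) (mult-other l (h≢x ∘ sym)) ⟨
    filter (h ℕₚ.<?_) (x ∷ l) ++ replicate (mult h (x ∷ l)) h ∎
    where open ≡-Reasoning
  ... | yes refl = begin
    h ∷ l
      ≡⟨ all≡⇒replicate all≡h ⟩
    replicate (length (h ∷ l)) h
      ≡⟨ cong (λ c → replicate c h) (mult-constant all≡h) ⟨
    replicate (mult h (h ∷ l)) h
      ≡⟨ cong (_++ replicate (mult h (h ∷ l)) h) (List.filter-none (h ℕₚ.<?_) (All.map (λ { refl → ℕₚ.<-irrefl refl }) all≡h)) ⟨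
    filter (h ℕₚ.<?_) (h ∷ l) ++ replicate (mult h (h ∷ l)) h ∎
    where
    open ≡-Reasoning
    all≡h : All (_≡ h) (h ∷ l)
    -- After a leading h, descent bounds every entry above by h, and the lower bound forces
    -- equality.
    all≡h = refl ∷ All.map (λ (y≤h , h≤y) → ℕₚ.≤-antisym y≤h h≤y) (All.zip (x≥l , h≤l))

  -- The window h, ..., h + k - 1 has to contain all parts, hence the two bounds. Stripping the
  -- copies of h from the end leaves parts above h with unchanged multiplicities, which fit the
  -- window that starts one higher.
  toParts-multsFrom : ∀ h k {l} → AllPairs (λ a b → b ≤ a) l → All (h ≤_) l → All (_< k ℕ.+ h) l →
                      toParts h (multsFrom h k l) ≡ l
  toParts-multsFrom h zero    desc []          []          = refl
  toParts-multsFrom h zero    desc (h≤x ∷ _)   (x<h ∷ _)   = ⊥-elim (ℕₚ.<⇒≱ x<h h≤x)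
  toParts-multsFrom h (suc k) {l} desc h≤l l<k+h = begin
    toParts (suc h) (multsFrom (suc h) k l) ++ replicate (mult h l) h
      ≡⟨ cong (λ cs → toParts (suc h) cs ++ replicate (mult h l) h) (multsFrom-cong (suc h) k λ v → mult-filter l) ⟨
    toParts (suc h) (multsFrom (suc h) k l′) ++ replicate (mult h l) h
      ≡⟨ cong (_++ replicate (mult h l) h) (toParts-multsFrom (suc h) k (AllPairs.filter⁺ _ desc) (All.all-filter (h ℕₚ.<?_) l)
           (All.filter⁺ _ (All.map (λ x< → ℕₚ.≤-trans x< (ℕₚ.≤-reflexive (sym (ℕₚ.+-suc k h)))) l<k+h))) ⟩
    l′ ++ replicate (mult h l) h
      ≡⟨ split-smallest desc h≤l ⟨
    l ∎
    where
    open ≡-Reasoning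
    l′ = filter (h ℕₚ.<?_) l

  multsFrom-⊆ : ∀ {xs l} h k → (∀ v → mult v l ∈ xs) → All (_∈ xs) (multsFrom h k l)
  multsFrom-⊆ h zero    m∈ = []
  multsFrom-⊆ h (suc k) m∈ = m∈ h ∷ multsFrom-⊆ (suc h) k m∈

  module _ {P : List ℕ → Set} (P? : Decidable P) (n : ℕ) where

    Selected? : Decidable (λ cs → sum (toParts 1 cs) ≡ n × P (toParts 1 cs))
    Selected? cs = (sum (toParts 1 cs) ℕₚ.≟ n) ×-dec P? (toParts 1 cs)

    -- Both lists are free of duplicates and have the same members, so they differ in order only and
    -- have equal sums of weights. Lists of length n suffice because the parts of a partition of n
    -- lie in 1, ..., n, and the fixed length makes the encoding injective.
    partitions↭toParts : ∀ {xs} → Unique xs → (∀ l → P l → ∀ v → mult v l ∈ xs) →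
      filter P? (partitionsOf n) ↭ map (toParts 1) (filter Selected? (listsOfLength n xs))
    partitions↭toParts {xs} xs! mults∈xs =
      ∼bag⇒↭ (unique∧set⇒bag (Unique.filter⁺ P? (partitionsOf-unique n)) unique (mk⇔ to from))
      where
      distinct : ∀ {L} → All (λ cs → length cs ≡ n) L → Unique L →
                 AllPairs (λ cs cs′ → toParts 1 cs ≢ toParts 1 cs′) L
      distinct []           []           = []
      distinct {cs ∷ _} (len ∷ lens) (cs∉L ∷ L!) =
        All.map (λ {cs′} (len′ , cs≢cs′) e → cs≢cs′ (toParts-injective 1 cs cs′ (trans len (sym len′)) e))
                (All.zip (lens , cs∉L))
        ∷ distinct lens L!

      unique : Unique (map (toParts 1) (filter Selected? (listsOfLength n xs)))
      unique = AllPairs.map⁺ (AllPairs.filter⁺ Selected?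
        (distinct (All.tabulate λ cs∈ → proj₂ (∈-listsOfLength⁻ n cs∈)) (listsOfLength-unique n xs!)))

      to : ∀ {l} → l ∈ filter P? (partitionsOf n) → l ∈ map (toParts 1) (filter Selected? (listsOfLength n xs))
      to {l} l∈ with ∈-filter⁻ P? {xs = partitionsOf n} l∈
      ... | l∈′ , Pl with ∈-partitionsOf⁻ l∈′
      ... | desc , pos , sum≡n = subst (_∈ _) eq (∈-map⁺ (toParts 1) (∈-filter⁺ Selected?
              (subst (λ k → multsFrom 1 n l ∈ listsOfLength k xs) (length-multsFrom 1 n l)
                (∈-listsOfLength⁺ (multsFrom-⊆ 1 n (mults∈xs l Pl))))
              (trans (cong sum eq) sum≡n , subst P (sym eq) Pl)))
        where
        eq : toParts 1 (multsFrom 1 n l) ≡ l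
        eq = toParts-multsFrom 1 n (Linked⇒AllPairs (λ a≥b b≥c → ℕₚ.≤-trans b≥c a≥b) desc) pos
               (All.map (λ x≤ → ℕₚ.≤-trans (s≤s x≤) (ℕₚ.≤-reflexive (trans (cong suc sum≡n) (ℕₚ.+-comm 1 n)))) (parts≤sum l))

      from : ∀ {l} → l ∈ map (toParts 1) (filter Selected? (listsOfLength n xs)) → l ∈ filter P? (partitionsOf n)
      from l∈ with ∈-map⁻ (toParts 1) l∈
      ... | cs , cs∈ , refl with ∈-filter⁻ Selected? {xs = listsOfLength n xs} cs∈
      ... | _ , sum≡n , Pl = ∈-filter⁺ P? (∈-partitionsOf⁺
              (AllPairs⇒Linked (toParts-descending 1 cs) , toParts-≥ 1 cs , sum≡n)) Pl

  sumℤ-↭ : ∀ {l l′} → l ↭ l′ → sumℤ l ≡ sumℤ l′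
  sumℤ-↭ p = foldr-commMonoid (setoid ℤ) ℤₚ.+-0-isCommutativeMonoid (↭⇒↭ₛ p)

-- The signature as a transfer along consecutive part values.

module Signature where

  open ≡
  open import Data.List.Relation.Unary.All using (All; []; _∷_)
  open import Data.List.Relation.Unary.Any using (here; there)
  open Partitions
  open import Data.Integer using (-_; _-_) renaming (_+_ to _+ℤ_)
  open import Data.Integer.Solver using () renaming (module +-*-Solver to ℤ-Solver)

  sumℤ-++ : ∀ l l′ → sumℤ (l ++ l′) ≡ sumℤ l +ℤ sumℤ l′
  sumℤ-++ []      l′ = sym (ℤₚ.+-identityˡ _)
  sumℤ-++ (x ∷ l) l′ = trans (cong (x +ℤ_) (sumℤ-++ l l′)) (sym (ℤₚ.+-assoc x _ _))

  Incident : Edge → Vertex → Set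
  Incident e v = proj₁ e ≡ v ⊎ proj₂ e ≡ v

  signedSum : List Vertex → List (List Edge) → ℤ
  signedSum V L = sumℤ (map (λ S → negOnePow (length S)) (filter (λ S → covers? S V) L))

  -- The vertices still to be covered are kept independent of the edges: dropping a vertex from the
  -- list records that an edge already chosen covers it.
  coverSum : List Edge → List Vertex → ℤ
  coverSum E V = signedSum V (subsets E)

  -- A relation in place of a filter: for a variable `h` the equality test on vertices does not
  -- reduce, whereas incidence can be supplied directly at each use.
  data Removes (e : Edge) : List Vertex → List Vertex → Set where
    []   : Removes e [] []
    hit  : ∀ {v V V′} → Incident e v → Removes e V V′ → Removes e (v ∷ V) V′
    miss : ∀ {v V V′} → ¬ Incident e v → Removes e V V′ → Removes e (v ∷ V) (v ∷ V′)

  Removes-++ : ∀ {e V V′ W W′} → Removes e V V′ → Removes e W W′ → Removes e (V ++ W) (V′ ++ W′)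
  Removes-++ []         s = s
  Removes-++ (hit i r)  s = hit i (Removes-++ r s)
  Removes-++ (miss i r) s = miss i (Removes-++ r s)

  Removes-none : ∀ {e V} → All (λ v → ¬ Incident e v) V → Removes e V V
  Removes-none []       = []
  Removes-none (i ∷ is) = miss i (Removes-none is)

  Covers-∷⁺ : ∀ {e S V V′} → Removes e V V′ → Covers S V′ → Covers (e ∷ S) V
  Covers-∷⁺ []         []       = []
  Covers-∷⁺ (hit i r)  cs       = here i ∷ Covers-∷⁺ r cs
  Covers-∷⁺ (miss _ r) (c ∷ cs) = there c ∷ Covers-∷⁺ r cs

  Covers-∷⁻ : ∀ {e S V V′} → Removes e V V′ → Covers (e ∷ S) V → Covers S V′
  Covers-∷⁻ []         []              = []
  Covers-∷⁻ (hit _ r)  (_ ∷ cs)        = Covers-∷⁻ r cs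
  Covers-∷⁻ (miss i r) (here i′ ∷ _)   = ⊥-elim (i i′)
  Covers-∷⁻ (miss _ r) (there c ∷ cs)  = c ∷ Covers-∷⁻ r cs

  signedSum-++ : ∀ V L L′ → signedSum V (L ++ L′) ≡ signedSum V L +ℤ signedSum V L′
  signedSum-++ V L L′ = trans
    (cong sumℤ (trans (cong (map _) (List.filter-++ (λ S → covers? S V) L L′)) (List.map-++ _ (filter _ L) (filter _ L′))))
    (sumℤ-++ (map _ (filter _ L)) _)

  signedSum-accept : ∀ {V S} L → Covers S V → signedSum V (S ∷ L) ≡ negOnePow (length S) +ℤ signedSum V L
  signedSum-accept {V} L c = cong (sumℤ ∘ map _) (List.filter-accept (λ S → covers? S V) c)

  signedSum-reject : ∀ {V S} L → ¬ Covers S V → signedSum V (S ∷ L) ≡ signedSum V L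
  signedSum-reject {V} L c = cong (sumℤ ∘ map _) (List.filter-reject (λ S → covers? S V) c)

  signedSum-map-∷ : ∀ {e V V′} → Removes e V V′ → ∀ L → signedSum V (map (e ∷_) L) ≡ - signedSum V′ L
  signedSum-map-∷ r [] = refl
  signedSum-map-∷ {e} {V} {V′} r (S ∷ L) with covers? S V′
  ... | yes c = begin
    signedSum V ((e ∷ S) ∷ map (e ∷_) L)               ≡⟨ signedSum-accept (map (e ∷_) L) (Covers-∷⁺ r c) ⟩
    - negOnePow (length S) +ℤ signedSum V (map (e ∷_) L) ≡⟨ cong (- negOnePow (length S) +ℤ_) (signedSum-map-∷ r L) ⟩
    - negOnePow (length S) +ℤ - signedSum V′ L          ≡⟨ ℤₚ.neg-distrib-+ (negOnePow (length S)) _ ⟨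
    - (negOnePow (length S) +ℤ signedSum V′ L)          ∎
    where open ≡-Reasoning
  ... | no ¬c = begin
    signedSum V ((e ∷ S) ∷ map (e ∷_) L)                ≡⟨ signedSum-reject (map (e ∷_) L) (¬c ∘ Covers-∷⁻ r) ⟩
    signedSum V (map (e ∷_) L)                          ≡⟨ signedSum-map-∷ r L ⟩
    - signedSum V′ L                                    ∎
    where open ≡-Reasoning

  -- Split by whether `e` is chosen. If it is, it contributes a sign and its endpoints are no longer
  -- demanded.
  coverSum-∷ : ∀ {e V V′} E → Removes e V V′ → coverSum (e ∷ E) V ≡ coverSum E V - coverSum E V′
  coverSum-∷ {e} {V} E r = trans (signedSum-++ V (subsets E) (map (e ∷_) (subsets E)))
                                   (cong (coverSum E V +ℤ_) (signedSum-map-∷ r (subsets E)))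

  subsets-All : {A : Set} {P : A → Set} {E : List A} → All P E → All (All P) (subsets E)
  subsets-All []       = [] ∷ []
  subsets-All (p ∷ ps) = All.++⁺ (subsets-All ps) (All.map⁺ (All.map (p ∷_) (subsets-All ps)))

  coverSum-none : ∀ E V → All (λ S → ¬ Covers S V) (subsets E) → coverSum E V ≡ + 0
  coverSum-none E V none = cong (sumℤ ∘ map _) (List.filter-none (λ S → covers? S V) none)

  coverSum-isolated : ∀ E v V → All (λ e → ¬ Incident e v) E → coverSum E (v ∷ V) ≡ + 0
  coverSum-isolated E v V isolated = coverSum-none E (v ∷ V)
    (All.map (λ { ¬i (c ∷ _) → All.All¬⇒¬Any ¬i c }) (subsets-All isolated))

  rung loop : ℕ → Edge
  rung h = (suc h , X) , (h , X)
  loop h = (h , X) , (h , Y)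

  verticesOf : ℕ → ℕ → List Vertex
  verticesOf 0             h = []
  verticesOf 1             h = (h , X) ∷ []
  verticesOf (suc (suc _)) h = (h , X) ∷ (h , Y) ∷ []

  rungsOf : ℕ → ℕ → ℕ → List Edge
  rungsOf (suc _) (suc _) h = rung h ∷ []
  rungsOf _       _       h = []

  loopsOf : ℕ → ℕ → List Edge
  loopsOf (suc (suc _)) h = loop h ∷ []
  loopsOf _             h = []

  next : List ℕ → ℕ
  next []      = 0
  next (c ∷ _) = c

  -- Vertices and edges of the graph of toParts h cs; Verts′ omits the vertex x_h.
  Verts Verts′ : ℕ → List ℕ → List Vertex
  Verts h []       = []
  Verts h (c ∷ cs) = verticesOf c h ++ Verts (suc h) cs
  Verts′ h []                   = []
  Verts′ h (suc (suc _) ∷ cs)   = (h , Y) ∷ Verts (suc h) cs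
  Verts′ h (_ ∷ cs)             = Verts (suc h) cs

  Edges : ℕ → List ℕ → List Edge
  Edges h []       = []
  Edges h (c ∷ cs) = rungsOf c (next cs) h ++ (loopsOf c h ++ Edges (suc h) cs)

  Verts-≥ : ∀ h cs → All (λ v → h ≤ proj₁ v) (Verts h cs)
  Verts-≥ h []       = []
  Verts-≥ h (c ∷ cs) = All.++⁺ (here≥ c) (All.map ℕₚ.<⇒≤ (Verts-≥ (suc h) cs))
    where
    here≥ : ∀ c → All (λ v → h ≤ proj₁ v) (verticesOf c h)
    here≥ 0             = []
    here≥ 1             = ℕₚ.≤-refl ∷ []
    here≥ (suc (suc _)) = ℕₚ.≤-refl ∷ ℕₚ.≤-refl ∷ []

  Edges-≥ : ∀ h cs → All (λ e → h ≤ proj₁ (proj₁ e) × h ≤ proj₁ (proj₂ e)) (Edges h cs)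
  Edges-≥ h []       = []
  Edges-≥ h (c ∷ cs) = All.++⁺ (rungs c (next cs)) (All.++⁺ (loops c)
    (All.map (λ (p , q) → ℕₚ.<⇒≤ p , ℕₚ.<⇒≤ q) (Edges-≥ (suc h) cs)))
    where
    rungs : ∀ c c′ → All (λ e → h ≤ proj₁ (proj₁ e) × h ≤ proj₁ (proj₂ e)) (rungsOf c c′ h)
    rungs zero    _       = []
    rungs (suc _) zero    = []
    rungs (suc _) (suc _) = (ℕₚ.n≤1+n h , ℕₚ.≤-refl) ∷ []
    loops : ∀ c → All (λ e → h ≤ proj₁ (proj₁ e) × h ≤ proj₁ (proj₂ e)) (loopsOf c h)
    loops 0             = []
    loops 1             = []
    loops (suc (suc _)) = (ℕₚ.≤-refl , ℕₚ.≤-refl) ∷ []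

  isolated-below : ∀ h t cs → All (λ e → ¬ Incident e (h , t)) (Edges (suc h) cs)
  isolated-below h t cs = All.map (λ { (p , _) (inj₁ refl) → ℕₚ.<-irrefl refl p
                                     ; (_ , q) (inj₂ refl) → ℕₚ.<-irrefl refl q }) (Edges-≥ (suc h) cs)

  rung-removes : ∀ h cs → 1 ≤ next cs → Removes (rung h) (Verts (suc h) cs) (Verts′ (suc h) cs)
  rung-removes h (1 ∷ cs)             _ = hit (inj₁ refl) (Removes-none (All.map
    (λ { 2+h≤ (inj₁ refl) → ℕₚ.<-irrefl refl 2+h≤ ; 2+h≤ (inj₂ refl) → ℕₚ.<-irrefl refl (ℕₚ.<⇒≤ 2+h≤) }) (Verts-≥ (suc (suc h)) cs)))
  rung-removes h (suc (suc _) ∷ cs) _ = hit (inj₁ refl) (miss (λ { (inj₁ ()) ; (inj₂ ()) }) (Removes-none (All.map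
    (λ { 2+h≤ (inj₁ refl) → ℕₚ.<-irrefl refl 2+h≤ ; 2+h≤ (inj₂ refl) → ℕₚ.<-irrefl refl (ℕₚ.<⇒≤ 2+h≤) }) (Verts-≥ (suc (suc h)) cs))))

  loop-removes-none : ∀ h {W} → All (λ v → suc h ≤ proj₁ v) W → Removes (loop h) W W
  loop-removes-none h W≥ = Removes-none (All.map (λ { h< (inj₁ refl) → ℕₚ.<-irrefl refl h< ; h< (inj₂ refl) → ℕₚ.<-irrefl refl h< }) W≥)

  Verts′-≥ : ∀ h cs → All (λ v → h ≤ proj₁ v) (Verts′ h cs)
  Verts′-≥ h []                   = []
  Verts′-≥ h (0 ∷ cs)             = All.map ℕₚ.<⇒≤ (Verts-≥ (suc h) cs)
  Verts′-≥ h (1 ∷ cs)             = All.map ℕₚ.<⇒≤ (Verts-≥ (suc h) cs)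
  Verts′-≥ h (suc (suc _) ∷ cs)   = ℕₚ.≤-refl ∷ All.map ℕₚ.<⇒≤ (Verts-≥ (suc h) cs)

  -- Transfer recursion along the part values: τ counts (with sign) the edge sets covering every
  -- vertex; τ′ those for which the lowest vertex x_h is already covered from below, and it is 0
  -- when x_h does not exist.
  τ τ′ : List ℕ → ℤ
  τ  []                  = + 1
  τ  (0 ∷ cs)            = τ cs
  τ  (1 ∷ cs)            = - τ′ cs
  τ  (suc (suc _) ∷ cs)  = - (τ cs - τ′ cs)
  τ′ []                  = + 0
  τ′ (0 ∷ cs)            = + 0
  τ′ (1 ∷ cs)            = τ cs - τ′ cs
  τ′ (suc (suc _) ∷ cs)  = - (τ cs - τ′ cs)

  τ′-0 : ∀ cs → next cs ≡ 0 → τ′ cs ≡ + 0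
  τ′-0 []       _    = refl
  τ′-0 (0 ∷ cs) _    = refl

  -- `F` and `F′` are the uncovered vertices at level h before and after the rung is taken. When the
  -- next part value is absent there is no rung, and the hypothesis that `y` is then 0 lets both
  -- cases share one formula.
  coverSum-rungs : ∀ h c cs E F F′ {x y} → Removes (rung h) F F′ →
    coverSum E (F ++ Verts (suc h) cs) ≡ x → (1 ≤ next cs → coverSum E (F′ ++ Verts′ (suc h) cs) ≡ y) →
    (next cs ≡ 0 → y ≡ + 0) → coverSum (rungsOf (suc c) (next cs) h ++ E) (F ++ Verts (suc h) cs) ≡ x - y
  coverSum-rungs h c cs E F F′ {x} r ≡x ≡y y≡0 with next cs in eq
  ... | zero  = trans ≡x (sym (trans (cong (λ y → x - y) (y≡0 refl)) (ℤₚ.+-identityʳ _)))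
  ... | suc m = trans (coverSum-∷ E (Removes-++ r (rung-removes h cs (subst (1 ≤_) (sym eq) (s≤s z≤n)))))
                      (cong₂ _-_ ≡x (≡y (s≤s z≤n)))

  -- With the rung already decided, only the loop touches level h. Leaving it out isolates `(h , t)`
  -- and contributes 0; taking it flips the sign and meets every demand at that level.
  coverSum-loop : ∀ h t cs F W → Removes (loop h) F [] → All (λ v → suc h ≤ proj₁ v) W →
    coverSum (loop h ∷ Edges (suc h) cs) (((h , t) ∷ F) ++ W) ≡ + 0 - coverSum (Edges (suc h) cs) W
  coverSum-loop h t cs F W r W≥ = trans
    (coverSum-∷ (Edges (suc h) cs) (hit (inc t) (Removes-++ r (loop-removes-none h W≥))))
    (cong (_- coverSum (Edges (suc h) cs) W) (coverSum-isolated (Edges (suc h) cs) (h , t) (F ++ W) (isolated-below h t cs)))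
    where
    inc : ∀ t → Incident (loop h) (h , t)
    inc X = inj₁ refl
    inc Y = inj₂ refl

  -- Edges are decided from the bottom up. A single uncovered x_h can only be reached by the rung
  -- above it, which is therefore forced. With two copies, y_h lies on the loop alone, so the loop
  -- is forced and the rung is free. Once x_h is covered from below, the rung is free for a single
  -- part too, while y_h still forces the loop.
  coverSum≡τ  : ∀ h cs → coverSum (Edges h cs) (Verts h cs) ≡ τ cs
  coverSum≡τ′ : ∀ h cs → 1 ≤ next cs → coverSum (Edges h cs) (Verts′ h cs) ≡ τ′ cs

  coverSum≡τ h []       = refl
  coverSum≡τ h (0 ∷ cs) = coverSum≡τ (suc h) cs
  coverSum≡τ h (1 ∷ cs) = trans
    (coverSum-rungs h 0 cs (Edges (suc h) cs) ((h , X) ∷ []) [] (hit (inj₂ refl) []) (coverSum-isolated (Edges (suc h) cs) (h , X) (Verts (suc h) cs) (isolated-below h X cs))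
      (coverSum≡τ′ (suc h) cs) (τ′-0 cs))
    (ℤₚ.+-identityˡ _)
  coverSum≡τ h (suc (suc c) ∷ cs) = trans
    (coverSum-rungs h (suc c) cs (loop h ∷ Edges (suc h) cs) ((h , X) ∷ (h , Y) ∷ []) ((h , Y) ∷ []) (hit (inj₂ refl) (miss (λ { (inj₁ ()) ; (inj₂ ()) }) []))
      (trans (coverSum-loop h X cs ((h , Y) ∷ []) (Verts (suc h) cs) (hit (inj₂ refl) []) (Verts-≥ (suc h) cs)) (cong (λ x → + 0 - x) (coverSum≡τ (suc h) cs)))
      (λ 1≤ → trans (coverSum-loop h Y cs [] (Verts′ (suc h) cs) [] (Verts′-≥ (suc h) cs)) (cong (λ x → + 0 - x) (coverSum≡τ′ (suc h) cs 1≤)))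
      (λ e → cong (λ x → + 0 - x) (τ′-0 cs e)))
    (solve 2 (λ x y → (con (+ 0) :- x) :- (con (+ 0) :- y) := :- (x :- y)) refl (τ cs) (τ′ cs))
    where open ℤ-Solver

  coverSum≡τ′ h (1 ∷ cs) _ = coverSum-rungs h 0 cs (Edges (suc h) cs) [] [] [] (coverSum≡τ (suc h) cs) (coverSum≡τ′ (suc h) cs) (τ′-0 cs)
  coverSum≡τ′ h (suc (suc c) ∷ cs) _ = trans
    (coverSum-rungs h (suc c) cs (loop h ∷ Edges (suc h) cs) ((h , Y) ∷ []) ((h , Y) ∷ []) (miss (λ { (inj₁ ()) ; (inj₂ ()) }) [])
      (trans (coverSum-loop h Y cs [] (Verts (suc h) cs) [] (Verts-≥ (suc h) cs)) (cong (λ x → + 0 - x) (coverSum≡τ (suc h) cs)))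
      (λ 1≤ → trans (coverSum-loop h Y cs [] (Verts′ (suc h) cs) [] (Verts′-≥ (suc h) cs)) (cong (λ x → + 0 - x) (coverSum≡τ′ (suc h) cs 1≤)))
      (λ e → cong (λ x → + 0 - x) (τ′-0 cs e)))
    (solve 2 (λ x y → (con (+ 0) :- x) :- (con (+ 0) :- y) := :- (x :- y)) refl (τ cs) (τ′ cs))
    where open ℤ-Solver

  concatFrom : {A : Set} → (ℕ → List A) → ℕ → ℕ → List A
  concatFrom f h zero    = []
  concatFrom f h (suc k) = f h ++ concatFrom f (suc h) k

  concatMap-range : {A : Set} (f : ℕ → List A) (g : ℕ → ℕ) → ∀ h k → (∀ i → suc (g i) ≡ h ℕ.+ i) →
                    concatMap f (map suc (applyUpTo g k)) ≡ concatFrom f h k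
  concatMap-range f g h zero    e = refl
  concatMap-range f g h (suc k) e = cong₂ _++_ (cong f (trans (e 0) (ℕₚ.+-identityʳ h)))
    (concatMap-range f (g ∘ suc) (suc h) k (λ i → trans (e (suc i)) (ℕₚ.+-suc h i)))

  mult-next : ∀ h cs → mult h (toParts h cs) ≡ next cs
  mult-next h []       = refl
  mult-next h (c ∷ cs) = mult-toParts-here h c cs

  concatFrom-Verts : ∀ f h cs → (∀ v → h ≤ v → f v ≡ verticesOf (mult v (toParts h cs)) v) →
                     concatFrom f h (length cs) ≡ Verts h cs
  concatFrom-Verts f h []       e = refl
  concatFrom-Verts f h (c ∷ cs) e = cong₂ _++_
    (trans (e h ℕₚ.≤-refl) (cong (λ c → verticesOf c h) (mult-toParts-here h c cs)))
    (concatFrom-Verts f (suc h) cs λ v h<v →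
      trans (e v (ℕₚ.<⇒≤ h<v)) (cong (λ c → verticesOf c v) (mult-toParts-≢ c cs (ℕₚ.>⇒≢ h<v))))

  concatFrom-Edges : ∀ f h cs → (∀ v → h ≤ v → f v ≡ rungsOf (mult v (toParts h cs)) (mult (suc v) (toParts h cs)) v
                                                     ++ loopsOf (mult v (toParts h cs)) v) →
                     concatFrom f h (length cs) ≡ Edges h cs
  concatFrom-Edges f h []       e = refl
  concatFrom-Edges f h (c ∷ cs) e = trans (cong₂ _++_
    (trans (e h ℕₚ.≤-refl) (cong₂ (λ c c′ → rungsOf c c′ h ++ loopsOf c h) (mult-toParts-here h c cs)
       (trans (mult-toParts-≢ c cs ℕₚ.1+n≢n) (mult-next (suc h) cs))))
    (concatFrom-Edges f (suc h) cs λ v h<v →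
      trans (e v (ℕₚ.<⇒≤ h<v)) (cong₂ (λ c c′ → rungsOf c c′ v ++ loopsOf c v) (mult-toParts-≢ c cs (ℕₚ.>⇒≢ h<v))
        (mult-toParts-≢ c cs (ℕₚ.>⇒≢ (ℕₚ.m<n⇒m<1+n h<v))))))
    (List.++-assoc (rungsOf c (next cs) h) (loopsOf c h) _)

  private
    -- The per-value functions inside `vertices` and `edges` are local definitions without an
    -- accessible name. Proving the equation by `refl` makes unification supply them as witnesses,
    -- which `verticesAt` and `edgesAt` project.
    vertices-concatMap : ∀ l → ∃ λ f → vertices l ≡ concatMap f (values l)
    vertices-concatMap l = _ , refl

    edges-concatMap : ∀ l → ∃ λ f → edges l ≡ concatMap f (values l)
    edges-concatMap l = _ , refl

  verticesAt : List ℕ → ℕ → List Vertex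
  verticesAt l = proj₁ (vertices-concatMap l)

  edgesAt : List ℕ → ℕ → List Edge
  edgesAt l = proj₁ (edges-concatMap l)

  verticesOf-0 : ∀ {c} h → ¬ 1 ≤ c → verticesOf c h ≡ []
  verticesOf-0 {zero}  h _   = refl
  verticesOf-0 {suc c} h c≱1 = ⊥-elim (c≱1 (s≤s z≤n))

  verticesOf-1 : ∀ {c} h → 1 ≤ c → ¬ 2 ≤ c → verticesOf c h ≡ (h , X) ∷ []
  verticesOf-1 {1}           h _ _   = refl
  verticesOf-1 {suc (suc c)} h _ c≱2 = ⊥-elim (c≱2 (s≤s (s≤s z≤n)))

  verticesOf-2 : ∀ {c} h → 2 ≤ c → verticesOf c h ≡ (h , X) ∷ (h , Y) ∷ []
  verticesOf-2 h (s≤s (s≤s _)) = refl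

  verticesAt≡ : ∀ l v → verticesAt l v ≡ verticesOf (mult v l) v
  verticesAt≡ l v with 1 ≤? mult v l | 2 ≤? mult v l
  ... | yes _ | yes p = sym (verticesOf-2 v p)
  ... | yes p | no ¬p = sym (verticesOf-1 v p ¬p)
  ... | no ¬p | _     = sym (verticesOf-0 v ¬p)

  rungsOf-1 : ∀ {c c′} h → 1 ≤ c → 1 ≤ c′ → rungsOf c c′ h ≡ rung h ∷ []
  rungsOf-1 h (s≤s _) (s≤s _) = refl

  rungsOf-0 : ∀ {c c′} h → ¬ (1 ≤ c × 1 ≤ c′) → rungsOf c c′ h ≡ []
  rungsOf-0 {zero}           h _ = refl
  rungsOf-0 {suc _} {zero}   h _ = refl
  rungsOf-0 {suc _} {suc _}  h ¬p = ⊥-elim (¬p (s≤s z≤n , s≤s z≤n))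

  loopsOf-1 : ∀ {c} h → 2 ≤ c → loopsOf c h ≡ loop h ∷ []
  loopsOf-1 h (s≤s (s≤s _)) = refl

  loopsOf-0 : ∀ {c} h → ¬ 2 ≤ c → loopsOf c h ≡ []
  loopsOf-0 {0}           h _  = refl
  loopsOf-0 {1}           h _  = refl
  loopsOf-0 {suc (suc _)} h ¬p = ⊥-elim (¬p (s≤s (s≤s z≤n)))

  edgesAt≡ : ∀ l v → edgesAt l v ≡ rungsOf (mult v l) (mult (suc v) l) v ++ loopsOf (mult v l) v
  edgesAt≡ l v with 1 ≤? mult (suc v) l | 1 ≤? mult v l | 2 ≤? mult v l
  ... | yes p | yes r | yes s = sym (cong₂ _++_ (rungsOf-1 v r p) (loopsOf-1 v s))
  ... | yes p | yes r | no ¬s = sym (cong₂ _++_ (rungsOf-1 v r p) (loopsOf-0 v ¬s))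
  ... | yes p | no ¬r | yes s = sym (cong₂ _++_ (rungsOf-0 v (¬r ∘ proj₁)) (loopsOf-1 v s))
  ... | yes p | no ¬r | no ¬s = sym (cong₂ _++_ (rungsOf-0 v (¬r ∘ proj₁)) (loopsOf-0 v ¬s))
  ... | no ¬p | _     | yes s = sym (cong₂ _++_ (rungsOf-0 v (¬p ∘ proj₂)) (loopsOf-1 v s))
  ... | no ¬p | _     | no ¬s = sym (cong₂ _++_ (rungsOf-0 v (¬p ∘ proj₂)) (loopsOf-0 v ¬s))

  -- `δ` scans the part values up to the sum of the partition, while `cs` describes those up to its
  -- own length; the hypothesis makes the two ranges coincide.
  δ≡τ : ∀ cs → sum (toParts 1 cs) ≡ length cs → δ (toParts 1 cs) ≡ τ cs
  δ≡τ cs sum≡len = begin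
    coverSum (edges l) (vertices l)      ≡⟨ cong₂ coverSum E≡ V≡ ⟩
    coverSum (Edges 1 cs) (Verts 1 cs)   ≡⟨ coverSum≡τ 1 cs ⟩
    τ cs                                 ∎
    where
    open ≡-Reasoning
    l = toParts 1 cs
    E≡ : edges l ≡ Edges 1 cs
    E≡ = begin
      edges l                             ≡⟨ concatMap-range (edgesAt l) id 1 (sum l) (λ _ → refl) ⟩
      concatFrom (edgesAt l) 1 (sum l)    ≡⟨ cong (concatFrom (edgesAt l) 1) sum≡len ⟩
      concatFrom (edgesAt l) 1 (length cs) ≡⟨ concatFrom-Edges (edgesAt l) 1 cs (λ v _ → edgesAt≡ l v) ⟩
      Edges 1 cs                          ∎
    V≡ : vertices l ≡ Verts 1 cs
    V≡ = begin
      vertices l                             ≡⟨ concatMap-range (verticesAt l) id 1 (sum l) (λ _ → refl) ⟩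
      concatFrom (verticesAt l) 1 (sum l)    ≡⟨ cong (concatFrom (verticesAt l) 1) sum≡len ⟩
      concatFrom (verticesAt l) 1 (length cs) ≡⟨ concatFrom-Verts (verticesAt l) 1 cs (λ v _ → verticesAt≡ l v) ⟩
      Verts 1 cs                             ∎

  -- τ restricted to the partitions without the part 1.
  τ₂ : List ℕ → ℤ
  τ₂ []           = τ []
  τ₂ (0 ∷ cs)     = τ cs
  τ₂ (suc _ ∷ cs) = + 0

  ρ : (ℕ → Bool) → ℕ → List ℕ → ℤ
  ρ good h []           = + 1
  ρ good h (0 ∷ cs)     = ρ good (suc h) cs
  ρ good h (suc _ ∷ cs) = if good h then - ρ good (suc h) cs else + 0

-- Finite products and antidiagonal sums in a commutative ring with integer scalars.

module QSeries (R : CommutativeRing 0ℓ 0ℓ)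
               (ι : CommutativeRing.rawRing ℤₚ.+-*-commutativeRing -Raw-AlmostCommutative⟶ fromCommutativeRing R)
               where

  open Partitions using (toParts; sum-toParts)
  open Signature using (τ; τ′; τ₂; ρ)
  open ℕ-Solver using () renaming (_:+_ to _⟨+⟩_; _:=_ to _⟨=⟩_; con to ⟨_⟩)
  open CommutativeRing R
  open import Algebra.Properties.Semiring.Exp semiring
  open import Relation.Binary.Reasoning.Setoid setoid
  open _-Raw-AlmostCommutative⟶_ ι

  private
    -- The scalars again, but with 0 and 1 mapped to 0# and 1# definitionally, as the solver requires.
    ⟦_⟧′ : ℤ → Carrier
    ⟦ + 0 ⟧′ = 0#
    ⟦ + 1 ⟧′ = 1#
    ⟦ c   ⟧′ = ⟦ c ⟧

    ⟦⟧′≈⟦⟧ : ∀ c → ⟦ c ⟧′ ≈ ⟦ c ⟧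
    ⟦⟧′≈⟦⟧ (+ 0)               = sym 0-homo
    ⟦⟧′≈⟦⟧ (+ 1)               = sym 1-homo
    ⟦⟧′≈⟦⟧ (+ (suc (suc _)))   = refl
    ⟦⟧′≈⟦⟧ -[1+ _ ]            = refl

    ι′ : CommutativeRing.rawRing ℤₚ.+-*-commutativeRing -Raw-AlmostCommutative⟶ fromCommutativeRing R
    ι′ = record
      { ⟦_⟧ = ⟦_⟧′
      ; +-homo = λ a b → trans (⟦⟧′≈⟦⟧ (a ℤ.+ b)) (trans (+-homo a b) (sym (+-cong (⟦⟧′≈⟦⟧ a) (⟦⟧′≈⟦⟧ b))))
      ; *-homo = λ a b → trans (⟦⟧′≈⟦⟧ (a ℤ.* b)) (trans (*-homo a b) (sym (*-cong (⟦⟧′≈⟦⟧ a) (⟦⟧′≈⟦⟧ b))))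
      ; -‿homo = λ a → trans (⟦⟧′≈⟦⟧ (ℤ.- a)) (trans (-‿homo a) (sym (-‿cong (⟦⟧′≈⟦⟧ a))))
      ; 0-homo = refl
      ; 1-homo = refl
      }

    _≟′_ : ∀ a b → Maybe (⟦ a ⟧′ ≈ ⟦ b ⟧′)
    a ≟′ b with a ℤₚ.≟ b
    ... | yes ≡.refl = just refl
    ... | no _       = nothing

  open import Algebra.Solver.Ring (CommutativeRing.rawRing ℤₚ.+-*-commutativeRing) (fromCommutativeRing R) ι′ _≟′_ using (Polynomial; con; solve; _:=_; _:+_; _:*_; _:-_; :-_)

  private
    :1 : ∀ {m} → Polynomial m
    :1 = con (+ 1)

  Π Σ : (ℕ → Carrier) → ℕ → Carrier
  Π f zero    = 1#
  Π f (suc n) = Π f n * f n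
  Σ f zero    = 0#
  Σ f (suc n) = Σ f n + f n

  Π-front : ∀ f n → Π f (suc n) ≈ f 0 * Π (f ∘ suc) n
  Π-front f zero    = *-comm 1# (f 0)
  Π-front f (suc n) = trans (*-congʳ (Π-front f n)) (*-assoc _ _ _)

  Π-cong : ∀ {f g} n → (∀ i → i ℕ.< n → f i ≈ g i) → Π f n ≈ Π g n
  Π-cong zero    p = refl
  Π-cong (suc n) p = *-cong (Π-cong n λ i i<n → p i (ℕₚ.m<n⇒m<1+n i<n)) (p n ℕₚ.≤-refl)

  Π≈1 : ∀ {f} n → (∀ i → f i ≈ 1#) → Π f n ≈ 1#
  Π≈1 zero    p = refl
  Π≈1 (suc n) p = trans (*-cong (Π≈1 n p) (p n)) (*-identityˡ 1#)

  Π-* : ∀ f g n → Π (λ i → f i * g i) n ≈ Π f n * Π g n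
  Π-* f g zero    = sym (*-identityˡ 1#)
  Π-* f g (suc n) = trans (*-congʳ (Π-* f g n))
    (solve 4 (λ a b c d → (a :* b) :* (c :* d) := (a :* c) :* (b :* d)) refl _ _ _ _)

  Π-+ : ∀ f m n → Π f (m ℕ.+ n) ≈ Π f m * Π (λ i → f (m ℕ.+ i)) n
  Π-+ f m zero    = trans (reflexive (≡.cong (Π f) (ℕₚ.+-identityʳ m))) (sym (*-identityʳ _))
  Π-+ f m (suc n) = trans (reflexive (≡.cong (Π f) (ℕₚ.+-suc m n)))
                          (trans (*-congʳ (Π-+ f m n)) (*-assoc _ _ _))

  Σ-cong : ∀ {f g} n → (∀ i → f i ≈ g i) → Σ f n ≈ Σ g n
  Σ-cong zero    p = refl
  Σ-cong (suc n) p = +-cong (Σ-cong n p) (p n)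

  -- poch Q m k = (1 − Q^(m+1)) ⋯ (1 − Q^(m+k))
  poch : Carrier → ℕ → ℕ → Carrier
  poch Q m = Π (λ i → 1# - Q ^ (suc m ℕ.+ i))

  poch-front : ∀ Q m k → poch Q m (suc k) ≈ (1# - Q ^ suc m) * poch Q (suc m) k
  poch-front Q m k = trans (Π-front _ k)
    (*-cong (reflexive (≡.cong (λ j → 1# - Q ^ suc j) (ℕₚ.+-identityʳ m)))
            (Π-cong k λ i _ → reflexive (≡.cong (λ j → 1# - Q ^ suc j) (ℕₚ.+-suc m i))))

  -- The sum over the antidiagonal a + b = m, listed from (m, 0) to (0, m).
  anti : (ℕ → ℕ → Carrier) → ℕ → Carrier
  anti f zero    = f 0 0
  anti f (suc m) = f (suc m) 0 + anti (λ a b → f a (suc b)) m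

  anti-last : ∀ f m → anti f (suc m) ≈ anti (λ a b → f (suc a) b) m + f 0 (suc m)
  anti-last f zero    = refl
  anti-last f (suc m) = trans (+-congˡ (anti-last (λ a b → f a (suc b)) m)) (sym (+-assoc _ _ _))

  anti-cong : ∀ {f g} m → (∀ a b → a ℕ.+ b ≡ m → f a b ≈ g a b) → anti f m ≈ anti g m
  anti-cong zero    p = p 0 0 ≡.refl
  anti-cong (suc m) p = +-cong (p (suc m) 0 (≡.cong suc (ℕₚ.+-identityʳ m)))
    (anti-cong m λ a b a+b≡m → p a (suc b) (≡.trans (ℕₚ.+-suc a b) (≡.cong suc a+b≡m)))

  anti-flip : ∀ f m → anti f m ≈ anti (flip f) m
  anti-flip f zero    = refl
  anti-flip f (suc m) = begin
    f (suc m) 0 + anti (λ a b → f a (suc b)) m         ≈⟨ +-congˡ (anti-flip _ m) ⟩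
    f (suc m) 0 + anti (λ a b → f b (suc a)) m         ≈⟨ +-comm _ _ ⟩
    anti (λ a b → f b (suc a)) m + f (suc m) 0         ≈⟨ anti-last (flip f) m ⟨
    anti (flip f) (suc m)                              ∎

  anti-+ : ∀ f g m → anti (λ a b → f a b + g a b) m ≈ anti f m + anti g m
  anti-+ f g zero    = refl
  anti-+ f g (suc m) = trans (+-congˡ (anti-+ _ _ m))
    (solve 4 (λ a b c d → (a :+ b) :+ (c :+ d) := (a :+ c) :+ (b :+ d)) refl _ _ _ _)

  anti-* : ∀ c f m → anti (λ a b → c * f a b) m ≈ c * anti f m
  anti-* c f zero    = refl
  anti-* c f (suc m) = trans (+-congˡ (anti-* c _ m)) (sym (distribˡ _ _ _))

  -- Inner entries of Pascal's triangle have two parents, border entries only one. Padding both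
  -- families of parents with 0 makes the split uniform.
  anti-pascal : ∀ {f g h} m →
    (∀ a → a ≡ m → f (suc a) 0 ≈ g a 0) → (∀ b → b ≡ m → f 0 (suc b) ≈ h 0 b) →
    (∀ a b → suc a ℕ.+ b ≡ m → f (suc a) (suc b) ≈ g a (suc b) + h (suc a) b) →
    anti f (suc m) ≈ anti g m + anti h m
  anti-pascal {f} {g} {h} m left right inner = begin
    anti f (suc m)                              ≈⟨ anti-cong (suc m) split ⟩
    anti (λ a b → g₀ a b + h₀ a b) (suc m)      ≈⟨ anti-+ g₀ h₀ (suc m) ⟩
    anti g₀ (suc m) + anti h₀ (suc m)           ≈⟨ +-congʳ (anti-last g₀ m) ⟩
    (anti g m + 0#) + (0# + anti h m)           ≈⟨ +-cong (+-identityʳ _) (+-identityˡ _) ⟩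
    anti g m + anti h m                         ∎
    where
    g₀ h₀ : ℕ → ℕ → Carrier
    g₀ zero    b = 0#
    g₀ (suc a) b = g a b
    h₀ a zero    = 0#
    h₀ a (suc b) = h a b
    split : ∀ a b → a ℕ.+ b ≡ suc m → f a b ≈ g₀ a b + h₀ a b
    split (suc a) zero    e = trans (left a (≡.trans (≡.sym (ℕₚ.+-identityʳ a)) (ℕₚ.suc-injective e))) (sym (+-identityʳ _))
    split zero    (suc b) e = trans (right b (ℕₚ.suc-injective e)) (sym (+-identityˡ _))
    split (suc a) (suc b) e = inner a b (≡.trans (≡.sym (ℕₚ.+-suc a b)) (ℕₚ.suc-injective e))

  -- Jacobi's triple product from the q-binomial theorem.

  module JacobiTriple (Q : Carrier) where

    -- binom a b is the Gaussian binomial [a+b, a], cleared of denominators by the factor (1 − Q) ⋯ (1 − Q^(a+b)).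
    binom : ℕ → ℕ → Carrier
    binom a b = poch Q a b * poch Q b a

    -- This rests on 1 - Q^(a+b+2) = (1 - Q^(a+1)) + Q^(a+1) (1 - Q^(b+1)). The factor in front
    -- appears because the left side is cleared by a product with one factor more than the clearing
    -- product of the two parents.
    binom-pascal : ∀ a b → binom (suc a) (suc b) ≈
                   (1# - Q ^ (2 ℕ.+ (a ℕ.+ b))) * (binom a (suc b) + Q ^ suc a * binom (suc a) b)
    binom-pascal a b = begin
      u * (1# - Q ^ (2 ℕ.+ (a ℕ.+ b))) * (v * (1# - Q ^ (2 ℕ.+ (b ℕ.+ a))))
        ≈⟨ *-cong (*-congˡ (top (ℕₚ.+-comm a b))) (*-congˡ (top ≡.refl)) ⟩
      u * (1# - Q * (Q ^ b * y)) * (v * (1# - Q * (Q ^ b * y)))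
        ≈⟨ solve 5 (λ u v q x y → u :* (:1 :- q :* (x :* y)) :* (v :* (:1 :- q :* (x :* y)))
             := (:1 :- q :* (x :* y)) :* ((:1 :- y) :* u :* v :+ y :* (u :* ((:1 :- q :* x) :* v)))) refl
             u v Q (Q ^ b) y ⟩
      (1# - Q * (Q ^ b * y)) * ((1# - y) * u * v + y * (u * ((1# - Q ^ suc b) * v)))
        ≈⟨ *-cong (top (ℕₚ.+-comm a b)) (+-cong (*-congʳ (poch-front Q a b)) (*-congˡ (*-congˡ (poch-front Q b a)))) ⟨
      (1# - Q ^ (2 ℕ.+ (a ℕ.+ b))) * (binom a (suc b) + y * binom (suc a) b) ∎
      where
      u = poch Q (suc a) b
      v = poch Q (suc b) a
      y = Q ^ suc a
      top : ∀ {m} → m ≡ b ℕ.+ a → 1# - Q ^ (2 ℕ.+ m) ≈ 1# - Q * (Q ^ b * y)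
      top ≡.refl = +-congˡ (-‿cong (*-congˡ (trans (reflexive (≡.cong (Q ^_) (≡.sym (ℕₚ.+-suc b a)))) (^-homo-* Q b (suc a)))))

    gsum : (ℕ → Carrier) → ℕ → Carrier
    gsum g = anti (λ a r → g r * binom a r)

    -- One step of the q-binomial theorem: each further factor 1 − c comes from Pascal's rule.
    gsum-suc : ∀ g c m → (∀ a r → a ℕ.+ r ≡ m → g (suc r) * Q ^ a ≈ - (c * g r)) →
               gsum g (suc m) ≈ (1# - Q ^ suc m) * (1# - c) * gsum g m
    gsum-suc g c m hyp = begin
      gsum g (suc m)
        ≈⟨ anti-pascal {f = λ a r → g r * binom a r} m left right inner ⟩
      anti (λ a r → k * (g r * binom a r)) m + anti (λ a r → k * (g (suc r) * Q ^ a * binom a r)) m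
        ≈⟨ +-congˡ (anti-cong m λ a r e → trans (*-congˡ (*-congʳ (hyp a r e)))
             (solve 4 (λ k c g b → k :* ((:- (c :* g)) :* b) := (:- (k :* c)) :* (g :* b)) refl _ _ _ _)) ⟩
      anti (λ a r → k * (g r * binom a r)) m + anti (λ a r → (- (k * c)) * (g r * binom a r)) m
        ≈⟨ +-cong (anti-* _ _ m) (anti-* _ _ m) ⟩
      k * gsum g m + (- (k * c)) * gsum g m
        ≈⟨ solve 3 (λ k c s → k :* s :+ (:- (k :* c)) :* s := k :* (:1 :- c) :* s) refl _ _ _ ⟩
      k * (1# - c) * gsum g m ∎
      where
      k = 1# - Q ^ suc m
      left : ∀ a → a ≡ m → g 0 * binom (suc a) 0 ≈ k * (g 0 * binom a 0)
      left a ≡.refl = solve 4 (λ o g p k → g :* (o :* (p :* k)) := k :* (g :* (o :* p))) refl 1# _ _ _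
      right : ∀ b → b ≡ m → g (suc b) * binom 0 (suc b) ≈ k * (g (suc b) * Q ^ 0 * binom 0 b)
      right b ≡.refl = solve 3 (λ g p k → g :* (p :* k :* :1) := k :* (g :* :1 :* (p :* :1))) refl _ _ _
      inner : ∀ a b → suc a ℕ.+ b ≡ m → g (suc b) * binom (suc a) (suc b) ≈
              k * (g (suc b) * binom a (suc b)) + k * (g (suc b) * Q ^ suc a * binom (suc a) b)
      inner a b ≡.refl = trans (*-congˡ (binom-pascal a b))
        (solve 5 (λ g k u y v → g :* (k :* (u :+ y :* v)) := k :* (g :* u) :+ k :* (g :* y :* v)) refl _ _ _ _ _)

    -- α a j = (−a)^j Q^(j(j−1)/2)
    α : Carrier → ℕ → Carrier
    α a zero    = 1#
    α a (suc j) = - (α a j * a * Q ^ j)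

    α-suc : ∀ a m i j → i ℕ.+ j ≡ m → α a (suc j) * Q ^ i ≈ - (a * Q ^ m * α a j)
    α-suc a m i j ≡.refl = trans
      (solve 4 (λ e a x y → (:- (e :* a :* y)) :* x := :- (a :* (x :* y) :* e)) refl (α a j) a (Q ^ i) (Q ^ j))
      (-‿cong (*-congʳ (*-congˡ (sym (^-homo-* Q i j)))))

    -- The finite q-binomial theorem, obtained by iterating `gsum-suc` with c = b Q^m. The factors 1
    -- - Q^(i+1) stem from the cleared denominators.
    gsum-α : ∀ b m → gsum (α b) m ≈ Π (λ i → (1# - Q ^ suc i) * (1# - b * Q ^ i)) m
    gsum-α b zero    = trans (*-identityˡ _) (*-identityˡ _)
    gsum-α b (suc m) = trans (gsum-suc (α b) (b * Q ^ m) m (α-suc b m)) (trans (*-comm _ _) (*-congʳ (gsum-α b m)))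

    module _ (a b : Carrier) (ab≈Q : a * b ≈ Q) where

      -- The bilateral sequence …, α b 2, α b 1, 1, α a 1, α a 2, … with 1 at position n.
      bilateral : ℕ → ℕ → Carrier
      bilateral zero    r       = α a r
      bilateral (suc n) zero    = α b (suc n)
      bilateral (suc n) (suc r) = bilateral n r

      bilateral-0 : ∀ n → bilateral n 0 ≡ α b n
      bilateral-0 zero    = ≡.refl
      bilateral-0 (suc n) = ≡.refl

      bilateral-left : ∀ i r → bilateral (i ℕ.+ r) r ≡ α b i
      bilateral-left i zero    = ≡.trans (≡.cong (λ j → bilateral j 0) (ℕₚ.+-identityʳ i)) (bilateral-0 i)
      bilateral-left i (suc r) = ≡.trans (≡.cong (λ j → bilateral j (suc r)) (ℕₚ.+-suc i r)) (bilateral-left i r)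

      bilateral-right : ∀ n j → bilateral n (n ℕ.+ j) ≡ α a j
      bilateral-right zero    j = ≡.refl
      bilateral-right (suc n) j = bilateral-right n j

      -- This is the hypothesis of `gsum-suc` for c = a Q^m and a sequence centred at n. Left of the
      -- centre the steps are governed by b and run in the opposite direction; a b = Q is what makes
      -- both arms obey the same law.
      bilateral-suc : ∀ n m i r → i ℕ.+ r ≡ n ℕ.+ m →
                      bilateral n (suc r) * Q ^ i ≈ - (a * Q ^ m * bilateral n r)
      bilateral-suc zero    m i r       e = α-suc a m i r e
      bilateral-suc (suc n) m i (suc r) e =
        bilateral-suc n m i r (ℕₚ.suc-injective (≡.trans (≡.sym (ℕₚ.+-suc i r)) e))
      bilateral-suc (suc n) m i zero    e = begin
        bilateral n 0 * Q ^ i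
          ≡⟨ ≡.cong₂ (λ f j → f * Q ^ j) (bilateral-0 n) (≡.trans (≡.sym (ℕₚ.+-identityʳ i)) e) ⟩
        α b n * (Q * Q ^ (n ℕ.+ m))
          ≈⟨ *-congˡ (*-cong (sym ab≈Q) (^-homo-* Q n m)) ⟩
        α b n * (a * b * (Q ^ n * Q ^ m))
          ≈⟨ solve 5 (λ e a b x y → e :* (a :* b :* (x :* y)) := :- (a :* y :* (:- (e :* b :* x)))) refl _ _ _ _ _ ⟩
        - (a * Q ^ m * α b (suc n)) ∎

      -- The finite form of the triple product, multiplied by (1 − Q) ⋯ (1 − Q^(n+m)).
      gsum-bilateral : ∀ n m → gsum (bilateral n) (n ℕ.+ m) ≈
        Π (λ i → (1# - Q ^ suc i) * (1# - b * Q ^ i)) n * Π (λ i → (1# - Q ^ suc (n ℕ.+ i)) * (1# - a * Q ^ i)) m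
      gsum-bilateral n zero = begin
        gsum (bilateral n) (n ℕ.+ 0)
          ≡⟨ ≡.cong (gsum (bilateral n)) (ℕₚ.+-identityʳ n) ⟩
        gsum (bilateral n) n
          -- Only the left arm is in range here, read backwards, so exchanging the two indices gives
          -- the one-sided sum.
          ≈⟨ anti-cong n (λ { i r ≡.refl → *-cong (reflexive (bilateral-left i r)) (*-comm _ _) }) ⟩
        anti (λ i r → α b i * binom r i) n
          ≈⟨ anti-flip _ n ⟩
        gsum (α b) n
          ≈⟨ gsum-α b n ⟩
        Π (λ i → (1# - Q ^ suc i) * (1# - b * Q ^ i)) n
          ≈⟨ *-identityʳ _ ⟨
        Π (λ i → (1# - Q ^ suc i) * (1# - b * Q ^ i)) n * 1# ∎
      gsum-bilateral n (suc m) = begin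
        gsum (bilateral n) (n ℕ.+ suc m)
          ≡⟨ ≡.cong (gsum (bilateral n)) (ℕₚ.+-suc n m) ⟩
        gsum (bilateral n) (suc (n ℕ.+ m))
          ≈⟨ gsum-suc (bilateral n) (a * Q ^ m) (n ℕ.+ m) (bilateral-suc n m) ⟩
        k * gsum (bilateral n) (n ℕ.+ m)
          ≈⟨ *-congˡ (gsum-bilateral n m) ⟩
        k * (x * y)
          ≈⟨ solve 3 (λ k x y → k :* (x :* y) := x :* (y :* k)) refl _ _ _ ⟩
        x * (y * k) ∎
        where
        k = (1# - Q ^ suc (n ℕ.+ m)) * (1# - a * Q ^ m)
        x = Π (λ i → (1# - Q ^ suc i) * (1# - b * Q ^ i)) n
        y = Π (λ i → (1# - Q ^ suc (n ℕ.+ i)) * (1# - a * Q ^ i)) m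

      theta : ℕ → Carrier
      theta N = 1# + Σ (λ m → α a (suc m) + α b (suc m)) N

      anti-bilateral : ∀ N → anti (λ _ r → bilateral N r) (N ℕ.+ N) ≈ theta N
      anti-bilateral zero    = sym (+-identityʳ 1#)
      anti-bilateral (suc N) = begin
        α b (suc N) + anti (λ _ r → bilateral N r) (N ℕ.+ suc N)
          ≡⟨ ≡.cong (λ j → α b (suc N) + anti (λ _ r → bilateral N r) j) (ℕₚ.+-suc N N) ⟩
        α b (suc N) + anti (λ _ r → bilateral N r) (suc (N ℕ.+ N))
          ≈⟨ +-congˡ (anti-last (λ _ r → bilateral N r) (N ℕ.+ N)) ⟩
        α b (suc N) + (anti (λ _ r → bilateral N r) (N ℕ.+ N) + bilateral N (suc (N ℕ.+ N)))
          ≈⟨ +-congˡ (+-cong (anti-bilateral N)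
               (reflexive (≡.trans (≡.cong (bilateral N) (≡.sym (ℕₚ.+-suc N N))) (bilateral-right N (suc N))))) ⟩
        α b (suc N) + (theta N + α a (suc N))
          ≈⟨ solve 4 (λ x s y o → x :+ (o :+ s :+ y) := o :+ (s :+ (y :+ x))) refl _ _ _ 1# ⟩
        theta (suc N) ∎

      module _ (n : ℕ) (Q^≈0 : ∀ {m} → n ℕ.< m → Q ^ m ≈ 0#) where

        1-Q^≈1 : ∀ {m} → n ℕ.< m → 1# - Q ^ m ≈ 1#
        1-Q^≈1 n<m = trans (+-congˡ (-‿cong (Q^≈0 n<m))) (solve 0 (:1 :- con (+ 0) := :1) refl)

        poch≈1 : ∀ i j → n ℕ.≤ i → poch Q i j ≈ 1#
        poch≈1 i j n≤i = Π≈1 j λ l → 1-Q^≈1 (s≤s (ℕₚ.≤-trans n≤i (ℕₚ.m≤m+n i l)))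

        α≈0 : ∀ c j → n ℕ.< j → α c (suc j) ≈ 0#
        α≈0 c j n<j = trans (-‿cong (*-congˡ (Q^≈0 n<j))) (solve 1 (λ x → :- (x :* con (+ 0)) := con (+ 0)) refl _)

        private
          N = suc (n ℕ.+ suc n)

        -- If both indices are at least n, every factor of `binom` is 1 after truncation. Otherwise
        -- the position is more than n + 1 away from the centre N = 2n + 2, and `α` vanishes there
        -- because it contains some Q^j with j > n. This determines the size of N.
        bilateral-binom : ∀ i r → i ℕ.+ r ≡ N ℕ.+ N → bilateral N r * binom i r ≈ bilateral N r
        bilateral-binom i r e with n ℕₚ.≤? i | n ℕₚ.≤? r
        ... | yes n≤i | yes n≤r = trans
          (*-congˡ (*-cong (poch≈1 i r n≤i) (poch≈1 r i n≤r)))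
          (solve 1 (λ x → x :* (:1 :* :1) := x) refl _)
        ... | no n≰i | _ = trans (*-congʳ vanish) (trans (zeroˡ _) (sym vanish))
          where
          i≤n = ℕₚ.≰⇒≥ n≰i
          j = n ℕ.∸ i ℕ.+ suc n
          r≡ : r ≡ N ℕ.+ suc j
          r≡ = ℕₚ.+-cancelˡ-≡ i r (N ℕ.+ suc j) (≡.trans e (≡.sym (≡.trans lemma
                 (≡.cong (λ t → N ℕ.+ suc (t ℕ.+ suc n)) (ℕₚ.m+[n∸m]≡n i≤n)))))
            where
            lemma : i ℕ.+ (N ℕ.+ suc j) ≡ N ℕ.+ suc (i ℕ.+ (n ℕ.∸ i) ℕ.+ suc n)
            lemma = ℕ-Solver.solve 4 (λ i N d s → i ⟨+⟩ (N ⟨+⟩ (⟨ 1 ⟩ ⟨+⟩ (d ⟨+⟩ s))) ⟨=⟩ N ⟨+⟩ (⟨ 1 ⟩ ⟨+⟩ (i ⟨+⟩ d ⟨+⟩ s)))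
                      ≡.refl i N (n ℕ.∸ i) (suc n)
          vanish : bilateral N r ≈ 0#
          vanish = trans (reflexive (≡.trans (≡.cong (bilateral N) r≡) (bilateral-right N (suc j))))
                         (α≈0 a j (ℕₚ.m≤n+m (suc n) _))
        ... | yes _ | no n≰r = trans (*-congʳ vanish) (trans (zeroˡ _) (sym vanish))
          where
          r≤n = ℕₚ.≰⇒≥ n≰r
          j = n ℕ.∸ r ℕ.+ suc n
          N≡ : N ≡ suc j ℕ.+ r
          N≡ = ≡.sym (≡.trans lemma (≡.cong (λ t → suc (t ℕ.+ suc n)) (ℕₚ.m+[n∸m]≡n r≤n)))
            where
            lemma : suc j ℕ.+ r ≡ suc (r ℕ.+ (n ℕ.∸ r) ℕ.+ suc n)
            lemma = ℕ-Solver.solve 3 (λ r d s → ⟨ 1 ⟩ ⟨+⟩ (d ⟨+⟩ s) ⟨+⟩ r ⟨=⟩ ⟨ 1 ⟩ ⟨+⟩ (r ⟨+⟩ d ⟨+⟩ s)) ≡.refl r (n ℕ.∸ r) (suc n)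
          vanish : bilateral N r ≈ 0#
          vanish = trans (reflexive (≡.trans (≡.cong (λ t → bilateral t r) N≡) (bilateral-left (suc j) r)))
                         (α≈0 b j (ℕₚ.m≤n+m (suc n) _))

        jacobi : Π (λ i → (1# - a * Q ^ i) * (1# - b * Q ^ i) * (1# - Q ^ suc i)) N ≈ theta N
        jacobi = begin
          Π (λ i → (1# - a * Q ^ i) * (1# - b * Q ^ i) * (1# - Q ^ suc i)) N
            ≈⟨ Π-cong N (λ i _ → solve 3 (λ x y z → x :* y :* z := (z :* y) :* x) refl _ _ _) ⟩
          Π (λ i → (1# - Q ^ suc i) * (1# - b * Q ^ i) * (1# - a * Q ^ i)) N
            ≈⟨ Π-* _ _ N ⟩
          Π (λ i → (1# - Q ^ suc i) * (1# - b * Q ^ i)) N * Π (λ i → 1# - a * Q ^ i) N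
            -- The factors 1 - Q^(N+i+1) equal 1 after truncation; inserting them produces the shape
            -- of `gsum-bilateral`.
            ≈⟨ *-congˡ (Π-cong N λ i _ → trans (*-congʳ (1-Q^≈1 (n<N+ i))) (*-identityˡ _)) ⟨
          Π (λ i → (1# - Q ^ suc i) * (1# - b * Q ^ i)) N * Π (λ i → (1# - Q ^ suc (N ℕ.+ i)) * (1# - a * Q ^ i)) N
            ≈⟨ gsum-bilateral N N ⟨
          gsum (bilateral N) (N ℕ.+ N)
            ≈⟨ anti-cong (N ℕ.+ N) bilateral-binom ⟩
          anti (λ _ r → bilateral N r) (N ℕ.+ N)
            ≈⟨ anti-bilateral N ⟩
          theta N ∎
          where
          n<N+ : ∀ i → n ℕ.< suc (N ℕ.+ i)
          n<N+ i = s≤s (ℕₚ.m≤n⇒m≤1+n (ℕₚ.≤-trans (ℕₚ.m≤m+n n (suc n)) (ℕₚ.m≤m+n _ i)))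

  -- The Rogers-Selberg series and the recurrence for the signature series.

  module RogersSelberg (q : Carrier) where

    p : ℕ → ℕ → Carrier
    p = poch q

    -- E (q ^ k) m = (−1)^m q^(2km + m(5m−1)/2)
    E : Carrier → ℕ → Carrier
    E x zero    = 1#
    E x (suc m) = - (E x m * (x * x) * (q ^ m * q ^ m * q ^ m * q ^ m * q ^ m) * (q * q))

    E-shift : ∀ x m → E (q * x) m ≈ E x m * (q ^ m * q ^ m)
    E-shift x zero    = sym (trans (*-identityˡ _) (*-identityˡ _))
    E-shift x (suc m) = begin
      - (E (q * x) m * (q * x * (q * x)) * (y * y * y * y * y) * (q * q))
        ≈⟨ -‿cong (*-congʳ (*-congʳ (*-congʳ (E-shift x m)))) ⟩
      - (E x m * (y * y) * (q * x * (q * x)) * (y * y * y * y * y) * (q * q))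
        ≈⟨ solve 4 (λ e x q y →
             :- (e :* (y :* y) :* (q :* x :* (q :* x)) :* (y :* y :* y :* y :* y) :* (q :* q))
             := (:- (e :* (x :* x) :* (y :* y :* y :* y :* y) :* (q :* q))) :* (q :* y :* (q :* y)))
             refl (E x m) x q y ⟩
      E x (suc m) * (q * y * (q * y)) ∎
      where y = q ^ m

    -- With μ = m + 1, the bracket equals (1 - q^(2μ+k)) (1 - q^(μ+1)) ⋯ (1 - q^(μ+k-1)). Written as
    -- a sum it also makes sense at k = 0, where it is 1 + q^μ in place of a quotient.
    term : ℕ → ℕ → Carrier
    term m k = E (q ^ k) (suc m) * (p (suc m) k + q ^ suc m * q ^ k * p m k)

    M : ℕ → ℕ → Carrier
    M N k = p 0 k + Σ (λ m → term m k) N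

    -- The telescoping certificate: `term m k` misses the recurrence of M by `w m k - w (suc m) k`,
    -- and the head `p 0 k` misses it by `- w 0 k`.
    w : ℕ → ℕ → Carrier
    w m k = E (q ^ k) (suc m) * p m k * (1# + q ^ suc m - q ^ suc m * q ^ suc m * q ^ k)

    p-suc : ∀ m k → p m (suc k) ≈ p m k * (1# - q ^ suc m * q ^ k)
    p-suc m k = *-congˡ (+-congˡ (-‿cong (^-homo-* q (suc m) k)))

    -- The relation (1 − y) u = (1 − x y) s between the two products makes the defect telescope.
    term-rec : ∀ m k → term m k ≈ term m (suc k) + q ^ suc k * term m (2 ℕ.+ k) + (w m k - w (suc m) k)
    term-rec m k = sym (begin
      term m (suc k) + q * x * term m (2 ℕ.+ k) + (w m k - w (suc m) k)
        ≈⟨ +-congʳ (+-cong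
             (*-cong (E-shift x (suc m)) (+-cong (p-suc (suc m) k) (*-congˡ (poch-front q m k))))
             (*-congˡ (*-cong
               (trans (E-shift (q * x) (suc m)) (*-congʳ (E-shift x (suc m))))
               (+-cong (trans (p-suc (suc m) (suc k)) (*-congʳ (p-suc (suc m) k)))
                       (*-congˡ (trans (poch-front q m (suc k)) (*-congˡ (p-suc (suc m) k)))))))) ⟩
      e * (y * y) * (u * (1# - q * y * x) + y * (q * x) * ((1# - y) * u))
      + q * x * (e * (y * y) * (y * y) * (u * (1# - q * y * x) * (1# - q * y * (q * x))
                                          + y * (q * (q * x)) * ((1# - y) * (u * (1# - q * y * x)))))
      + (e * s * (1# + y - y * y * x)
         - (- (e * (x * x) * (y * y * y * y * y) * (q * q))) * u * (1# + q * y - q * y * (q * y) * x))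
        ≈⟨ solve 6 (λ e u s x y q →
            e :* (y :* y) :* (u :* (:1 :- q :* y :* x) :+ y :* (q :* x) :* ((:1 :- y) :* u))
            :+ q :* x :* (e :* (y :* y) :* (y :* y) :* (u :* (:1 :- q :* y :* x) :* (:1 :- q :* y :* (q :* x))
                                          :+ y :* (q :* (q :* x)) :* ((:1 :- y) :* (u :* (:1 :- q :* y :* x)))))
            :+ (e :* s :* (:1 :+ y :- y :* y :* x)
               :- (:- (e :* (x :* x) :* (y :* y :* y :* y :* y) :* (q :* q))) :* u :* (:1 :+ q :* y :- q :* y :* (q :* y) :* x))
            := e :* (u :+ y :* x :* s) :- e :* (:1 :+ y) :* ((:1 :- y) :* u :- s :* (:1 :- y :* x)))
            refl e u s x y q ⟩
      term m k - e * (1# + y) * ((1# - y) * u - s * (1# - y * x))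
        -- Both products are `p m (suc k)`, peeled at its first and at its last factor.
        ≈⟨ +-congˡ (-‿cong (*-congˡ (+-congʳ (trans (sym (poch-front q m k)) (p-suc m k))))) ⟩
      term m k - e * (1# + y) * (s * (1# - y * x) - s * (1# - y * x))
        ≈⟨ solve 3 (λ t f r → t :- f :* (r :- r) := t) refl _ _ _ ⟩
      term m k ∎)
      where
      x = q ^ k
      y = q ^ suc m
      u = p (suc m) k
      s = p m k
      e = E x (suc m)

    -- After telescoping only `w N k` is left over. Its factor `E (q ^ k) (suc N)` vanishes modulo
    -- q^(n+1) as soon as N exceeds n.
    M-rec : ∀ N k → M N k ≈ M N (suc k) + q ^ suc k * M N (2 ℕ.+ k) - w N k
    M-rec zero    k = sym (begin
      p 0 (suc k) + 0# + q * x * (p 0 (2 ℕ.+ k) + 0#) - w 0 k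
        ≈⟨ +-congʳ (+-cong (+-congʳ (p-suc 0 k)) (*-congˡ (+-congʳ (trans (p-suc 0 (suc k)) (*-congʳ (p-suc 0 k)))))) ⟩
      u * (1# - q * 1# * x) + 0# + q * x * (u * (1# - q * 1# * x) * (1# - q * 1# * (q * x)) + 0#)
        - (- (1# * (x * x) * (1# * 1# * 1# * 1# * 1#) * (q * q))) * u * (1# + q * 1# - q * 1# * (q * 1#) * x)
        ≈⟨ solve 3 (λ u x q →
             u :* (:1 :- q :* :1 :* x) :+ con (+ 0) :+ q :* x :* (u :* (:1 :- q :* :1 :* x) :* (:1 :- q :* :1 :* (q :* x)) :+ con (+ 0))
             :- (:- (:1 :* (x :* x) :* (:1 :* :1 :* :1 :* :1 :* :1) :* (q :* q))) :* u :* (:1 :+ q :* :1 :- q :* :1 :* (q :* :1) :* x)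
             := u :+ con (+ 0)) refl u x q ⟩
      u + 0# ∎)
      where
      x = q ^ k
      u = p 0 k
    M-rec (suc N) k = begin
      p 0 k + (Σ (λ m → term m k) N + term N k)  ≈⟨ +-assoc _ _ _ ⟨
      M N k + term N k                           ≈⟨ +-cong (M-rec N k) (term-rec N k) ⟩
      (p 0 (suc k) + a) + z * (p 0 (2 ℕ.+ k) + b) - w N k
        + (term N (suc k) + z * term N (2 ℕ.+ k) + (w N k - w (suc N) k))
        ≈⟨ solve 9 (λ u v a b z w t t′ w′ → (u :+ a) :+ z :* (v :+ b) :- w :+ (t :+ z :* t′ :+ (w :- w′))
                     := (u :+ (a :+ t)) :+ z :* (v :+ (b :+ t′)) :- w′) refl
             (p 0 (suc k)) (p 0 (2 ℕ.+ k)) a b z (w N k) (term N (suc k)) (term N (2 ℕ.+ k)) (w (suc N) k) ⟩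
      M (suc N) (suc k) + z * M (suc N) (2 ℕ.+ k) - w (suc N) k ∎
      where
      a = Σ (λ m → term m (suc k)) N
      b = Σ (λ m → term m (2 ℕ.+ k)) N
      z = q ^ suc k

    -- The recursions of `τ` and `τ′` summed over the multiplicities 0, 1, 2 of the k part values h,
    -- ..., h + k - 1, each part h weighted by q^h.
    A B : ℕ → ℕ → Carrier
    A zero    h = 1#
    A (suc k) h = A k (suc h) - q ^ h * B k (suc h) - q ^ h * q ^ h * (A k (suc h) - B k (suc h))
    B zero    h = 0#
    B (suc k) h = (q ^ h - q ^ h * q ^ h) * (A k (suc h) - B k (suc h))

    -- The difference no longer involves `B`, so the coupled pair becomes a second-order recurrence
    -- for `A` alone.
    A-B : ∀ k h → A (suc k) h - B (suc k) h ≈ (1# - q ^ h) * A k (suc h)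
    A-B k h = solve 3 (λ x a b → (a :- x :* b :- x :* x :* (a :- b)) :- (x :- x :* x) :* (a :- b)
                                 := (:1 :- x) :* a) refl _ _ _

    A-rec : ∀ k h → A (2 ℕ.+ k) h ≈ (1# - q ^ h) * (A (suc k) (suc h) + q ^ h * ((1# - q ^ suc h) * A k (2 ℕ.+ h)))
    A-rec k h = trans
      (solve 3 (λ x a b → a :- x :* b :- x :* x :* (a :- b) := (:1 :- x) :* (a :+ x :* (a :- b))) refl _ _ _)
      (*-congˡ (+-congˡ (*-congˡ (A-B k (suc h)))))

    -- Generating functions over lists of multiplicities.

    weigh : (List ℕ → ℤ) → (List ℕ → ℕ) → List (List ℕ) → Carrier
    weigh W s []       = 0#
    weigh W s (cs ∷ L) = ⟦ W cs ⟧ * q ^ s cs + weigh W s L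

    weigh-++ : ∀ W s L L′ → weigh W s (L ++ L′) ≈ weigh W s L + weigh W s L′
    weigh-++ W s []       L′ = sym (+-identityˡ _)
    weigh-++ W s (cs ∷ L) L′ = trans (+-congˡ (weigh-++ W s L L′)) (sym (+-assoc _ _ _))

    weigh-map : ∀ W s c {s′ m} L → (∀ cs → s (c ∷ cs) ≡ s′ cs ℕ.+ m) →
                weigh W s (map (c ∷_) L) ≈ q ^ m * weigh (λ cs → W (c ∷ cs)) s′ L
    weigh-map W s c          []       e = sym (zeroʳ _)
    weigh-map W s c {s′} {m} (cs ∷ L) e = begin
      ⟦ W (c ∷ cs) ⟧ * q ^ s (c ∷ cs) + weigh W s (map (c ∷_) L)
        ≈⟨ +-cong (*-congˡ (trans (reflexive (≡.cong (q ^_) (e cs))) (^-homo-* q (s′ cs) m))) (weigh-map W s c L e) ⟩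
      ⟦ W (c ∷ cs) ⟧ * (q ^ s′ cs * q ^ m) + q ^ m * weigh (λ cs → W (c ∷ cs)) s′ L
        ≈⟨ solve 4 (λ a x y w → a :* (x :* y) :+ y :* w := y :* (a :* x :+ w)) refl _ _ _ _ ⟩
      q ^ m * (⟦ W (c ∷ cs) ⟧ * q ^ s′ cs + weigh (λ cs → W (c ∷ cs)) s′ L) ∎

    weigh-neg : ∀ W s L → weigh (λ cs → ℤ.- W cs) s L ≈ - weigh W s L
    weigh-neg W s []       = solve 0 (con (+ 0) := :- con (+ 0)) refl
    weigh-neg W s (cs ∷ L) = trans (+-cong (*-congʳ (-‿homo (W cs))) (weigh-neg W s L))
      (solve 3 (λ a x w → (:- a) :* x :+ (:- w) := :- (a :* x :+ w)) refl _ _ _)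

    weigh-sub : ∀ W W′ s L → weigh (λ cs → W cs ℤ.- W′ cs) s L ≈ weigh W s L - weigh W′ s L
    weigh-sub W W′ s []       = solve 0 (con (+ 0) := con (+ 0) :- con (+ 0)) refl
    weigh-sub W W′ s (cs ∷ L) = trans
      (+-cong (*-congʳ (trans (+-homo (W cs) (ℤ.- W′ cs)) (+-congˡ (-‿homo (W′ cs))))) (weigh-sub W W′ s L))
      (solve 5 (λ a b x w w′ → (a :- b) :* x :+ (w :- w′) := (a :* x :+ w) :- (b :* x :+ w′)) refl _ _ _ _ _)

    weigh-0 : ∀ s L → weigh (λ _ → + 0) s L ≈ 0#
    weigh-0 s []       = refl
    weigh-0 s (cs ∷ L) = trans (+-cong (*-congʳ 0-homo) (weigh-0 s L))
      (solve 1 (λ x → con (+ 0) :* x :+ con (+ 0) := con (+ 0)) refl _)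

    partWeight : ℕ → List ℕ → ℕ
    partWeight h cs = sum (toParts h cs)

    gf : List ℕ → (List ℕ → ℤ) → ℕ → ℕ → Carrier
    gf xs W k h = weigh W (partWeight h) (listsOfLength k xs)

    gf-neg : ∀ xs W k h → gf xs (λ cs → ℤ.- W cs) k h ≈ - gf xs W k h
    gf-neg xs W k h = weigh-neg W (partWeight h) (listsOfLength k xs)

    gf-0 : ∀ xs k h → gf xs (λ _ → + 0) k h ≈ 0#
    gf-0 xs k h = weigh-0 (partWeight h) (listsOfLength k xs)

    gf₂ gf₁ : (List ℕ → ℤ) → ℕ → ℕ → Carrier
    gf₂ = gf (0 ∷ 1 ∷ 2 ∷ [])
    gf₁ = gf (0 ∷ 1 ∷ [])

    gf₂-suc : ∀ W k h → gf₂ W (suc k) h ≈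
      gf₂ (λ cs → W (0 ∷ cs)) k (suc h) + q ^ h * gf₂ (λ cs → W (1 ∷ cs)) k (suc h)
      + q ^ h * q ^ h * gf₂ (λ cs → W (2 ∷ cs)) k (suc h)
    gf₂-suc W k h = begin
      weigh W s (map (0 ∷_) L ++ map (1 ∷_) L ++ map (2 ∷_) L ++ [])
        ≈⟨ weigh-++ W s (map (0 ∷_) L) _ ⟩
      weigh W s (map (0 ∷_) L) + weigh W s (map (1 ∷_) L ++ map (2 ∷_) L ++ [])
        ≈⟨ +-congˡ (trans (weigh-++ W s (map (1 ∷_) L) _) (+-congˡ (weigh-++ W s (map (2 ∷_) L) []))) ⟩
      weigh W s (map (0 ∷_) L) + (weigh W s (map (1 ∷_) L) + (weigh W s (map (2 ∷_) L) + 0#))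
        ≈⟨ +-cong (weigh-map W s 0 L (sum-toParts h 0)) (+-cong
             (trans (weigh-map W s 1 L (sum-toParts h 1)) (*-congʳ (reflexive (≡.cong (q ^_) (ℕₚ.+-identityʳ h)))))
             (+-congʳ (trans (weigh-map W s 2 L (sum-toParts h 2)) (*-congʳ (trans (^-homo-* q h (h ℕ.+ 0))
               (*-congˡ (reflexive (≡.cong (q ^_) (ℕₚ.+-identityʳ h))))))))) ⟩
      1# * g 0 + (q ^ h * g 1 + (q ^ h * q ^ h * g 2 + 0#))
        ≈⟨ solve 4 (λ x a b c → :1 :* a :+ (x :* b :+ (x :* x :* c :+ con (+ 0))) := a :+ x :* b :+ x :* x :* c) refl _ _ _ _ ⟩
      g 0 + q ^ h * g 1 + q ^ h * q ^ h * g 2 ∎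
      where
      s = partWeight h
      L = listsOfLength k (0 ∷ 1 ∷ 2 ∷ [])
      g : ℕ → Carrier
      g c = gf₂ (λ cs → W (c ∷ cs)) k (suc h)

    gf₁-suc : ∀ W k h → gf₁ W (suc k) h ≈
      gf₁ (λ cs → W (0 ∷ cs)) k (suc h) + q ^ h * gf₁ (λ cs → W (1 ∷ cs)) k (suc h)
    gf₁-suc W k h = begin
      weigh W s (map (0 ∷_) L ++ map (1 ∷_) L ++ [])
        ≈⟨ trans (weigh-++ W s (map (0 ∷_) L) _) (+-congˡ (weigh-++ W s (map (1 ∷_) L) [])) ⟩
      weigh W s (map (0 ∷_) L) + (weigh W s (map (1 ∷_) L) + 0#)
        ≈⟨ +-cong (weigh-map W s 0 L (sum-toParts h 0)) (+-congʳ
             (trans (weigh-map W s 1 L (sum-toParts h 1)) (*-congʳ (reflexive (≡.cong (q ^_) (ℕₚ.+-identityʳ h)))))) ⟩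
      1# * gf₁ (λ cs → W (0 ∷ cs)) k (suc h) + (q ^ h * gf₁ (λ cs → W (1 ∷ cs)) k (suc h) + 0#)
        ≈⟨ +-cong (*-identityˡ _) (+-identityʳ _) ⟩
      gf₁ (λ cs → W (0 ∷ cs)) k (suc h) + q ^ h * gf₁ (λ cs → W (1 ∷ cs)) k (suc h) ∎
      where
      s = partWeight h
      L = listsOfLength k (0 ∷ 1 ∷ [])

    gf-τ≈A  : ∀ k h → gf₂ τ k h ≈ A k h
    gf-τ′≈B : ∀ k h → gf₂ τ′ k h ≈ B k h
    gf-τ-τ′ : ∀ k h → gf₂ (λ cs → τ cs ℤ.- τ′ cs) k h ≈ A k h - B k h

    gf-τ-τ′ k h = trans (weigh-sub τ τ′ (partWeight h) (listsOfLength k (0 ∷ 1 ∷ 2 ∷ []))) (+-cong (gf-τ≈A k h) (-‿cong (gf-τ′≈B k h)))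

    gf-τ≈A zero    h = trans (+-congʳ (*-congʳ 1-homo)) (solve 0 (:1 :* :1 :+ con (+ 0) := :1) refl)
    gf-τ≈A (suc k) h = begin
      gf₂ τ (suc k) h
        ≈⟨ gf₂-suc τ k h ⟩
      gf₂ τ k (suc h) + q ^ h * gf₂ (λ cs → ℤ.- τ′ cs) k (suc h)
        + q ^ h * q ^ h * gf₂ (λ cs → ℤ.- (τ cs ℤ.- τ′ cs)) k (suc h)
        ≈⟨ +-cong (+-cong (gf-τ≈A k (suc h)) (*-congˡ (trans (gf-neg (0 ∷ 1 ∷ 2 ∷ []) τ′ k (suc h)) (-‿cong (gf-τ′≈B k (suc h))))))
                  (*-congˡ (trans (gf-neg (0 ∷ 1 ∷ 2 ∷ []) (λ cs → τ cs ℤ.- τ′ cs) k (suc h)) (-‿cong (gf-τ-τ′ k (suc h))))) ⟩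
      A k (suc h) + q ^ h * - B k (suc h) + q ^ h * q ^ h * - (A k (suc h) - B k (suc h))
        ≈⟨ solve 3 (λ x a b → a :+ x :* (:- b) :+ x :* x :* (:- (a :- b)) := a :- x :* b :- x :* x :* (a :- b)) refl _ _ _ ⟩
      A (suc k) h ∎

    gf-τ′≈B zero    h = trans (+-congʳ (*-congʳ 0-homo)) (solve 0 (con (+ 0) :* :1 :+ con (+ 0) := con (+ 0)) refl)
    gf-τ′≈B (suc k) h = begin
      gf₂ τ′ (suc k) h
        ≈⟨ gf₂-suc τ′ k h ⟩
      gf₂ (λ _ → + 0) k (suc h) + q ^ h * gf₂ (λ cs → τ cs ℤ.- τ′ cs) k (suc h)
        + q ^ h * q ^ h * gf₂ (λ cs → ℤ.- (τ cs ℤ.- τ′ cs)) k (suc h)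
        ≈⟨ +-cong (+-cong (gf-0 (0 ∷ 1 ∷ 2 ∷ []) k (suc h)) (*-congˡ (gf-τ-τ′ k (suc h))))
                  (*-congˡ (trans (gf-neg (0 ∷ 1 ∷ 2 ∷ []) (λ cs → τ cs ℤ.- τ′ cs) k (suc h)) (-‿cong (gf-τ-τ′ k (suc h))))) ⟩
      0# + q ^ h * (A k (suc h) - B k (suc h)) + q ^ h * q ^ h * - (A k (suc h) - B k (suc h))
        ≈⟨ solve 2 (λ x d → con (+ 0) :+ x :* d :+ x :* x :* (:- d) := (x :- x :* x) :* d) refl _ _ ⟩
      B (suc k) h ∎

    gf-τ₂≈A : ∀ k → gf₂ τ₂ (suc k) 1 ≈ A k 2
    gf-τ₂≈A k = begin
      gf₂ τ₂ (suc k) 1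
        ≈⟨ gf₂-suc τ₂ k 1 ⟩
      gf₂ τ k 2 + q ^ 1 * gf₂ (λ _ → + 0) k 2 + q ^ 1 * q ^ 1 * gf₂ (λ _ → + 0) k 2
        ≈⟨ +-cong (+-cong (gf-τ≈A k 2) (*-congˡ (gf-0 (0 ∷ 1 ∷ 2 ∷ []) k 2))) (*-congˡ (gf-0 (0 ∷ 1 ∷ 2 ∷ []) k 2)) ⟩
      A k 2 + q ^ 1 * 0# + q ^ 1 * q ^ 1 * 0#
        ≈⟨ solve 2 (λ a x → a :+ x :* con (+ 0) :+ x :* x :* con (+ 0) := a) refl _ _ ⟩
      A k 2 ∎

    factor : Bool → ℕ → Carrier
    factor good v = if good then 1# - q ^ v else 1#

    gf-ρ : ∀ good k h → gf₁ (ρ good h) k h ≈ Π (λ j → factor (good (h ℕ.+ j)) (h ℕ.+ j)) k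
    gf-ρ good zero    h = trans (+-congʳ (*-congʳ 1-homo)) (solve 0 (:1 :* :1 :+ con (+ 0) := :1) refl)
    gf-ρ good (suc k) h = begin
      gf₁ (ρ good h) (suc k) h
        ≈⟨ gf₁-suc (ρ good h) k h ⟩
      g + q ^ h * gf₁ (λ cs → if good h then ℤ.- ρ good (suc h) cs else + 0) k (suc h)
        ≈⟨ collect (good h) ⟩
      factor (good h) h * g
        ≈⟨ *-cong (reflexive (≡.cong (λ v → factor (good v) v) (≡.sym (ℕₚ.+-identityʳ h))))
                  (trans (gf-ρ good k (suc h)) (Π-cong k λ j _ → reflexive (≡.cong (λ v → factor (good v) v) (≡.sym (ℕₚ.+-suc h j))))) ⟩
      factor (good (h ℕ.+ 0)) (h ℕ.+ 0) * Π (λ j → factor (good (h ℕ.+ suc j)) (h ℕ.+ suc j)) k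
        ≈⟨ Π-front _ k ⟨
      Π (λ j → factor (good (h ℕ.+ j)) (h ℕ.+ j)) (suc k) ∎
      where
      g = gf₁ (ρ good (suc h)) k (suc h)
      collect : ∀ b → g + q ^ h * gf₁ (λ cs → if b then ℤ.- ρ good (suc h) cs else + 0) k (suc h) ≈ factor b h * g
      collect true  = trans (+-congˡ (*-congˡ (gf-neg (0 ∷ 1 ∷ []) (ρ good (suc h)) k (suc h))))
        (solve 2 (λ x g → g :+ x :* (:- g) := (:1 :- x) :* g) refl _ _)
      collect false = trans (+-congˡ (*-congˡ (gf-0 (0 ∷ 1 ∷ []) k (suc h))))
        (solve 2 (λ x g → g :+ x :* con (+ 0) := :1 :* g) refl _ _)

    -- Consequences of q^(n+1) = 0.

    module Truncated (n : ℕ) (q-nilpotent : q ^ suc n ≈ 0#) where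

      q^≈0 : ∀ {m} → n ℕ.< m → q ^ m ≈ 0#
      q^≈0 {m} n<m = begin
        q ^ m                                ≡⟨ ≡.cong (q ^_) (ℕₚ.m+[n∸m]≡n n<m) ⟨
        q ^ (suc n ℕ.+ (m ℕ.∸ suc n))        ≈⟨ ^-homo-* q (suc n) _ ⟩
        q ^ suc n * q ^ (m ℕ.∸ suc n)        ≈⟨ *-congʳ q-nilpotent ⟩
        0# * q ^ (m ℕ.∸ suc n)               ≈⟨ zeroˡ _ ⟩
        0#                                   ∎

      E≈0 : ∀ x m → n ℕ.< m → E x (suc m) ≈ 0#
      E≈0 x m n<m = begin
        - (E x m * (x * x) * (q ^ m * q ^ m * q ^ m * q ^ m * q ^ m) * (q * q))
          ≈⟨ -‿cong (*-congʳ (*-congˡ (*-congˡ (q^≈0 n<m)))) ⟩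
        - (E x m * (x * x) * (q ^ m * q ^ m * q ^ m * q ^ m * 0#) * (q * q))
          ≈⟨ solve 4 (λ e x y q → :- (e :* (x :* x) :* (y :* y :* y :* y :* con (+ 0)) :* (q :* q)) := con (+ 0))
               refl _ _ _ _ ⟩
        0# ∎

      square≈0 : ∀ m → n ℕ.< m ℕ.+ m → q ^ m * q ^ m ≈ 0#
      square≈0 m n<m+m = trans (sym (^-homo-* q m m)) (q^≈0 n<m+m)

      -- Every term beyond the head is divisible by the square of q^(k+1); this is the concrete form
      -- of the behaviour for large k.
      term≈0 : ∀ m k → n ℕ.< suc k ℕ.+ suc k → term m k ≈ 0#
      term≈0 m k n<2k+2 = begin
        - (E x m * (x * x) * y⁵ * (q * q)) * t
          ≈⟨ solve 5 (λ e x y q t → :- (e :* (x :* x) :* y :* (q :* q)) :* t := (q :* x :* (q :* x)) :* (:- (e :* y :* t)))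
               refl (E x m) x y⁵ q t ⟩
        q ^ suc k * q ^ suc k * - (E x m * y⁵ * t) ≈⟨ *-congʳ (square≈0 (suc k) n<2k+2) ⟩
        0# * - (E x m * y⁵ * t) ≈⟨ zeroˡ _ ⟩
        0# ∎
        where
        x = q ^ k
        y⁵ = q ^ m * q ^ m * q ^ m * q ^ m * q ^ m
        t = p (suc m) k + q ^ suc m * q ^ k * p m k

      M≈p : ∀ N k → n ℕ.< suc k ℕ.+ suc k → M N k ≈ p 0 k
      M≈p zero    k n<2k+2 = +-identityʳ _
      M≈p (suc N) k n<2k+2 = begin
        p 0 k + (Σ (λ m → term m k) N + term N k) ≈⟨ +-assoc _ _ _ ⟨
        M N k + term N k                          ≈⟨ +-cong (M≈p N k n<2k+2) (term≈0 N k n<2k+2) ⟩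
        p 0 k + 0#                                ≈⟨ +-identityʳ _ ⟩
        p 0 k                                     ∎

      M-rec-truncated : ∀ {N} k → n ℕ.< N → M N k ≈ M N (suc k) + q ^ suc k * M N (2 ℕ.+ k)
      M-rec-truncated {N} k n<N = begin
        M N k
          ≈⟨ M-rec N k ⟩
        M N (suc k) + q ^ suc k * M N (2 ℕ.+ k) - w N k
          ≈⟨ +-congˡ (-‿cong (*-congʳ (*-congʳ (E≈0 (q ^ k) N n<N)))) ⟩
        M N (suc k) + q ^ suc k * M N (2 ℕ.+ k) - 0# * p N k * (1# + q ^ suc N - q ^ suc N * q ^ suc N * q ^ k)
          ≈⟨ solve 3 (λ a b c → a :- con (+ 0) :* b :* c := a) refl _ _ _ ⟩
        M N (suc k) + q ^ suc k * M N (2 ℕ.+ k) ∎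

      -- A finite induction in place of the limit. `A k (suc j)` sees the part values j + 1, ..., j
      -- + k, and n ≤ k + j says that none up to n is left out at the top. The recurrence has order
      -- two, hence two base cases; in both of them 2(j + 1) > n, so `M N j` has shrunk to its head.
      p*A≈M : ∀ {N} k j → n ℕ.< N → n ℕ.≤ k ℕ.+ j → p 0 j * A k (suc j) ≈ M N j
      p*A≈M {N} zero j n<N n≤j =
        trans (*-identityʳ _) (sym (M≈p N j (s≤s (ℕₚ.≤-trans n≤j (ℕₚ.m≤m+n j (suc j))))))
      p*A≈M {N} (suc zero) j n<N n≤1+j = begin
        p 0 j * (1# - z * 0# - z * z * (1# - 0#)) ≈⟨ *-congˡ (+-congˡ (-‿cong (*-congʳ (square≈0 (suc j) n<2j+2)))) ⟩
        p 0 j * (1# - z * 0# - 0# * (1# - 0#))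
          ≈⟨ solve 2 (λ p z → p :* (:1 :- z :* con (+ 0) :- con (+ 0) :* (:1 :- con (+ 0))) := p) refl _ _ ⟩
        p 0 j ≈⟨ M≈p N j n<2j+2 ⟨
        M N j ∎
        where
        z = q ^ suc j
        n<2j+2 : n ℕ.< suc j ℕ.+ suc j
        n<2j+2 = s≤s (ℕₚ.≤-trans n≤1+j (ℕₚ.m≤n+m (suc j) j))
      p*A≈M {N} (suc (suc k)) j n<N n≤ = begin
        p 0 j * A (2 ℕ.+ k) (suc j)
          ≈⟨ *-congˡ (A-rec k (suc j)) ⟩
        p 0 j * ((1# - z) * (A (suc k) (2 ℕ.+ j) + z * ((1# - q ^ (2 ℕ.+ j)) * A k (3 ℕ.+ j))))
          -- The factors in `A-rec` extend `p 0 j` to `p 0 (suc j)` and `p 0 (2 + j)`, which leaves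
          -- the plain recurrence of M.
          ≈⟨ solve 6 (λ p z a b z′ o → p :* ((o :- z) :* (a :+ z :* ((o :- z′) :* b)))
               := (p :* (o :- z)) :* a :+ z :* (((p :* (o :- z)) :* (o :- z′)) :* b)) refl
               (p 0 j) z (A (suc k) (2 ℕ.+ j)) (A k (3 ℕ.+ j)) (q ^ (2 ℕ.+ j)) 1# ⟩
        p 0 (suc j) * A (suc k) (2 ℕ.+ j) + z * (p 0 (2 ℕ.+ j) * A k (3 ℕ.+ j))
          ≈⟨ +-cong (p*A≈M (suc k) (suc j) n<N (ℕₚ.≤-trans n≤ (ℕₚ.≤-reflexive (≡.sym (≡.cong suc (ℕₚ.+-suc k j))))))
                    (*-congˡ (p*A≈M k (2 ℕ.+ j) n<N (ℕₚ.≤-trans n≤ (ℕₚ.≤-reflexive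
                      (≡.sym (≡.trans (ℕₚ.+-suc k (suc j)) (≡.cong suc (ℕₚ.+-suc k j)))))))) ⟩
        M N (suc j) + z * M N (2 ℕ.+ j)
          ≈⟨ M-rec-truncated j n<N ⟨
        M N j ∎
        where z = q ^ suc j

      -- 1 - q is a unit modulo q^(n+1), with inverse 1 + q + ⋯ + q^n. For i = 1 the product formula
      -- is first reached multiplied by this factor.
      cancel-1-q : ∀ {f g} → (1# - q) * f ≈ (1# - q) * g → f ≈ g
      cancel-1-q {f} {g} eq = begin
        f                                  ≈⟨ inverse f ⟨
        Σ (q ^_) (suc n) * ((1# - q) * f)  ≈⟨ *-congˡ eq ⟩
        Σ (q ^_) (suc n) * ((1# - q) * g)  ≈⟨ inverse g ⟩
        g                                  ∎
        where
        geometric : ∀ m → Σ (q ^_) m * (1# - q) ≈ 1# - q ^ m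
        geometric zero    = solve 1 (λ q → con (+ 0) :* (:1 :- q) := :1 :- :1) refl q
        geometric (suc m) = begin
          (Σ (q ^_) m + q ^ m) * (1# - q)              ≈⟨ distribʳ _ _ _ ⟩
          Σ (q ^_) m * (1# - q) + q ^ m * (1# - q)     ≈⟨ +-congʳ (geometric m) ⟩
          1# - q ^ m + q ^ m * (1# - q)
            ≈⟨ solve 2 (λ y q → :1 :- y :+ y :* (:1 :- q) := :1 :- q :* y) refl _ _ ⟩
          1# - q ^ suc m                               ∎
        inverse : ∀ f → Σ (q ^_) (suc n) * ((1# - q) * f) ≈ f
        inverse f = begin
          Σ (q ^_) (suc n) * ((1# - q) * f) ≈⟨ *-assoc _ _ _ ⟨
          Σ (q ^_) (suc n) * (1# - q) * f   ≈⟨ *-congʳ (geometric (suc n)) ⟩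
          (1# - q ^ suc n) * f              ≈⟨ *-congʳ (+-congˡ (-‿cong q-nilpotent)) ⟩
          (1# - 0#) * f                     ≈⟨ solve 1 (λ f → (:1 :- con (+ 0)) :* f := f) refl f ⟩
          f                                 ∎

      Q : Carrier
      Q = q ^ 5

      open JacobiTriple Q

      Q^≈ : ∀ m → Q ^ m ≈ q ^ m * q ^ m * q ^ m * q ^ m * q ^ m
      Q^≈ zero    = solve 0 (:1 := :1 :* :1 :* :1 :* :1 :* :1) refl
      Q^≈ (suc m) = trans (*-congˡ (Q^≈ m))
        (solve 2 (λ q y → q :* (q :* (q :* (q :* (q :* :1)))) :* (y :* y :* y :* y :* y)
                 := q :* y :* (q :* y) :* (q :* y) :* (q :* y) :* (q :* y)) refl q (q ^ m))

      Q^≈0 : ∀ {m} → n ℕ.< m → Q ^ m ≈ 0#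
      Q^≈0 {m} n<m = trans (^-assocʳ q 5 m) (q^≈0 (ℕₚ.≤-trans n<m (ℕₚ.m≤n*m m 5)))

      private
        N : ℕ
        N = suc (n ℕ.+ suc n)

        n<N : n ℕ.< N
        n<N = s≤s (ℕₚ.m≤m+n n (suc n))

      -- The cases k = 0 and k = 1 as theta series and triple products.

      triple : Carrier → Carrier → ℕ → Carrier
      triple a b i = (1# - a * Q ^ i) * (1# - b * Q ^ i) * (1# - Q ^ suc i)

      module Second where

        a b : Carrier
        a = q ^ 2
        b = q ^ 3

        ab≈Q : a * b ≈ Q
        ab≈Q = sym (^-homo-* q 2 3)

        α-a : ∀ m → α a m ≈ E 1# m
        α-a zero    = refl
        α-a (suc m) = -‿cong (trans (*-cong (*-congʳ (α-a m)) (Q^≈ m))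
          (solve 3 (λ e q y → e :* (q :* (q :* :1)) :* y := e :* (:1 :* :1) :* y :* (q :* q)) refl _ _ _))

        α-b : ∀ m → α b m ≈ E 1# m * q ^ m
        α-b zero    = sym (*-identityʳ 1#)
        α-b (suc m) = trans (-‿cong (*-cong (*-congʳ (α-b m)) (Q^≈ m)))
          (solve 4 (λ e q y z → :- (e :* y :* (q :* (q :* (q :* :1))) :* z)
                   := (:- (e :* (:1 :* :1) :* z :* (q :* q))) :* (q :* y)) refl (E 1# m) q (q ^ m) _)

        -- At k = 0 the two summands of `term` are the two arms of the theta series: a = q^2 and b =
        -- q^3 with base q^5 give the exponents m(5m - 1)/2 and m(5m + 1)/2.
        M₀ : ∀ m → M m 0 ≈ theta a b ab≈Q m
        M₀ m = +-congˡ (Σ-cong m λ j → begin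
          E 1# (suc j) * (1# + q ^ suc j * 1# * 1#)
            ≈⟨ solve 2 (λ e y → e :* (:1 :+ y :* :1 :* :1) := e :+ e :* y) refl _ _ ⟩
          E 1# (suc j) + E 1# (suc j) * q ^ suc j
            ≈⟨ +-cong (α-a (suc j)) (α-b (suc j)) ⟨
          α a (suc j) + α b (suc j) ∎)

        A≈product : ∀ k → n ℕ.≤ k → A k 1 ≈ Π (triple a b) N
        A≈product k n≤k = begin
          A k 1                 ≈⟨ *-identityˡ _ ⟨
          p 0 0 * A k 1         ≈⟨ p*A≈M k 0 n<N (ℕₚ.≤-trans n≤k (ℕₚ.≤-reflexive (≡.sym (ℕₚ.+-identityʳ k)))) ⟩
          M N 0                 ≈⟨ M₀ N ⟩
          theta a b ab≈Q N      ≈⟨ jacobi a b ab≈Q n Q^≈0 ⟨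
          Π (triple a b) N      ∎

      module First where

        a b : Carrier
        a = q ^ 1
        b = q ^ 4

        ab≈Q : a * b ≈ Q
        ab≈Q = sym (^-homo-* q 1 4)

        α-b : ∀ m → α b m ≈ E (q ^ 1) m
        α-b zero    = refl
        α-b (suc m) = -‿cong (trans (*-cong (*-congʳ (α-b m)) (Q^≈ m))
          (solve 3 (λ e q y → e :* (q :* (q :* (q :* (q :* :1)))) :* y
                   := e :* (q :* :1 :* (q :* :1)) :* y :* (q :* q)) refl _ _ _))

        α-a : ∀ m → α a (suc m) ≈ - (E (q ^ 1) m * (q ^ m * q ^ m * q))
        α-a zero    = solve 1 (λ q → :- (:1 :* (q :* :1) :* :1) := :- (:1 :* (:1 :* :1 :* q))) refl q
        α-a (suc m) = trans (-‿cong (*-cong (*-congʳ (α-a m)) (*-congˡ (Q^≈ m))))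
          (solve 3 (λ e q y → :- ((:- (e :* (y :* y :* q))) :* (q :* :1) :* (q :* (q :* (q :* (q :* (q :* :1)))) :* (y :* y :* y :* y :* y)))
                   := :- ((:- (e :* (q :* :1 :* (q :* :1)) :* (y :* y :* y :* y :* y) :* (q :* q))) :* (q :* y :* (q :* y) :* q)))
                   refl (E (q ^ 1) m) q (q ^ m))

        -- At k = 1 the term carrying `E (q ^ 1) m` splits into `α b m` and `α a (suc m)`. The arm
        -- of a thus runs one step ahead: the head 1 - q already contains `α a 1`, and one surplus
        -- term remains at the end.
        M₁ : ∀ m → M m 1 ≈ theta a b ab≈Q m + α a (suc m)
        M₁ zero    = solve 1 (λ q → :1 :* (:1 :- q :* :1) :+ con (+ 0) := :1 :+ con (+ 0) :+ (:- (:1 :* (q :* :1) :* :1))) refl q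
        M₁ (suc m) = begin
          p 0 1 + (Σ (λ j → term j 1) m + term m 1)
            ≈⟨ +-assoc _ _ _ ⟨
          M m 1 + term m 1
            ≈⟨ +-cong (M₁ m) (*-congˡ (+-cong (p-suc (suc m) 0) (*-congˡ (p-suc m 0)))) ⟩
          (1# + s) + α a (suc m) + e * (1# * (1# - q * y * 1#) + y * (q * 1#) * (1# * (1# - y * 1#)))
            ≈⟨ solve 6 (λ o s x e q y → (o :+ s) :+ x :+ e :* (:1 :* (:1 :- q :* y :* :1) :+ y :* (q :* :1) :* (:1 :* (:1 :- y :* :1)))
                 := o :+ (s :+ (x :+ e)) :+ (:- (e :* (y :* y :* q)))) refl 1# s (α a (suc m)) e q y ⟩
          (1# + (s + (α a (suc m) + e))) + - (e * (y * y * q))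
            ≈⟨ +-cong (+-congˡ (+-congˡ (+-congˡ (sym (α-b (suc m)))))) (sym (α-a (suc m))) ⟩
          theta a b ab≈Q (suc m) + α a (suc (suc m)) ∎
          where
          s = Σ (λ j → α a (suc j) + α b (suc j)) m
          e = E (q ^ 1) (suc m)
          y = q ^ suc m

        A≈product : ∀ k → n ℕ.≤ suc k → (1# - q) * A k 2 ≈ Π (triple a b) N
        A≈product k n≤1+k = begin
          (1# - q) * A k 2
            ≈⟨ solve 2 (λ q x → (:1 :- q) :* x := :1 :* (:1 :- q :* :1) :* x) refl _ _ ⟩
          p 0 1 * A k 2
            ≈⟨ p*A≈M k 1 n<N (ℕₚ.≤-trans n≤1+k (ℕₚ.≤-reflexive (ℕₚ.+-comm 1 k))) ⟩
          M N 1
            ≈⟨ M₁ N ⟩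
          theta a b ab≈Q N + α a (suc N)
            ≈⟨ +-congˡ (α≈0 a b ab≈Q n Q^≈0 a N n<N) ⟩
          theta a b ab≈Q N + 0#
            ≈⟨ +-identityʳ _ ⟩
          theta a b ab≈Q N
            ≈⟨ jacobi a b ab≈Q n Q^≈0 ⟨
          Π (triple a b) N ∎

      -- Grouping the parts by residue modulo 5.

      factor≈1 : ∀ good {v} → n ℕ.< v → factor good v ≈ 1#
      factor≈1 true  n<v = trans (+-congˡ (-‿cong (q^≈0 n<v))) (solve 0 (:1 :- con (+ 0) := :1) refl)
      factor≈1 false n<v = refl

      partProduct : (ℕ → Bool) → ℕ → Carrier
      partProduct good = Π (λ j → factor (good (suc j)) (suc j))

      partProduct-extend : ∀ good k l → n ℕ.≤ k → partProduct good (k ℕ.+ l) ≈ partProduct good k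
      partProduct-extend good k l n≤k = trans (Π-+ _ k l)
        (trans (*-congˡ (Π≈1 l λ i → factor≈1 (good _) (s≤s (ℕₚ.≤-trans n≤k (ℕₚ.m≤m+n k i))))) (*-identityʳ _))

      -- Factors beyond q^n are 1, so any two cut-offs from n on agree. This aligns the product over
      -- the parts up to k with whole blocks of five.
      partProduct-stable : ∀ good {k l} → n ℕ.≤ k → n ℕ.≤ l → partProduct good k ≈ partProduct good l
      partProduct-stable good {k} {l} n≤k n≤l = begin
        partProduct good k           ≈⟨ partProduct-extend good k l n≤k ⟨
        partProduct good (k ℕ.+ l)   ≡⟨ ≡.cong (partProduct good) (ℕₚ.+-comm k l) ⟩
        partProduct good (l ℕ.+ k)   ≈⟨ partProduct-extend good l k n≤l ⟩
        partProduct good l           ∎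

      1-q^≈ : ∀ r m → 1# - q ^ (r ℕ.+ m ℕ.* 5) ≈ 1# - q ^ r * Q ^ m
      1-q^≈ r m = +-congˡ (-‿cong (trans (^-homo-* q r (m ℕ.* 5))
        (*-congˡ (trans (reflexive (≡.cong (q ^_) (ℕₚ.*-comm m 5))) (sym (^-assocʳ q 5 m))))))

      n≤N*5 : n ℕ.≤ N ℕ.* 5
      n≤N*5 = ℕₚ.≤-trans (ℕₚ.<⇒≤ n<N) (ℕₚ.m≤m*n N 5)

      block : (ℕ → Bool) → ℕ → Carrier
      block good m = Π (λ r → factor (good (suc (r ℕ.+ m ℕ.* 5))) (suc (r ℕ.+ m ℕ.* 5))) 5

      partProduct-blocks : ∀ good {a b} → (∀ m → block good m ≈ triple a b m) →
        ∀ {k} → n ℕ.≤ k → partProduct good k ≈ Π (triple a b) N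
      partProduct-blocks good {a} {b} block≈ n≤k =
        trans (partProduct-stable good n≤k n≤N*5) (blocks N)
        where
        blocks : ∀ m → partProduct good (m ℕ.* 5) ≈ Π (triple a b) m
        blocks zero    = refl
        blocks (suc m) = begin
          partProduct good (m ℕ.* 5) * f 0 * f 1 * f 2 * f 3 * f 4
            ≈⟨ solve 6 (λ p a b c d e → p :* a :* b :* c :* d :* e := p :* (:1 :* a :* b :* c :* d :* e)) refl _ _ _ _ _ _ ⟩
          partProduct good (m ℕ.* 5) * (1# * f 0 * f 1 * f 2 * f 3 * f 4)
            ≈⟨ *-cong (blocks m) (block≈ m) ⟩
          Π (triple a b) m * triple a b m ∎
          where
          f : ℕ → Carrier
          f r = factor (good (suc (r ℕ.+ m ℕ.* 5))) (suc (r ℕ.+ m ℕ.* 5))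

      A≈partProduct₂ : ∀ good →
        (∀ m → good (1 ℕ.+ m ℕ.* 5) ≡ false) → (∀ m → good (2 ℕ.+ m ℕ.* 5) ≡ true) →
        (∀ m → good (3 ℕ.+ m ℕ.* 5) ≡ true) → (∀ m → good (4 ℕ.+ m ℕ.* 5) ≡ false) →
        (∀ m → good (5 ℕ.+ m ℕ.* 5) ≡ true) →
        ∀ k → n ℕ.≤ k → A k 1 ≈ partProduct good k
      A≈partProduct₂ good g₁ g₂ g₃ g₄ g₅ k n≤k =
        trans (Second.A≈product k n≤k) (sym (partProduct-blocks good block≈ n≤k))
        where
        block≈ : ∀ m → block good m ≈ triple (q ^ 2) (q ^ 3) m
        block≈ m rewrite g₁ m | g₂ m | g₃ m | g₄ m | g₅ m = begin
          1# * 1# * (1# - q ^ (2 ℕ.+ m ℕ.* 5)) * (1# - q ^ (3 ℕ.+ m ℕ.* 5)) * 1# * (1# - q ^ (5 ℕ.+ m ℕ.* 5))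
            ≈⟨ *-cong (*-congʳ (*-cong (*-congˡ (1-q^≈ 2 m)) (1-q^≈ 3 m))) (1-q^≈ 5 m) ⟩
          1# * 1# * (1# - q ^ 2 * Q ^ m) * (1# - q ^ 3 * Q ^ m) * 1# * (1# - Q ^ suc m)
            ≈⟨ solve 3 (λ x y z → :1 :* :1 :* x :* y :* :1 :* z := x :* y :* z) refl _ _ _ ⟩
          triple (q ^ 2) (q ^ 3) m ∎

      -- `good` and `good′` can differ at the part 1, which `good` rejects. The triple product
      -- contains 1 - q for it, the same factor stands before `A k 2`, and the two are cancelled.
      A≈partProduct₁ : ∀ good good′ → good 1 ≡ false → (∀ v → good (2 ℕ.+ v) ≡ good′ (2 ℕ.+ v)) →
        (∀ m → good′ (1 ℕ.+ m ℕ.* 5) ≡ true) → (∀ m → good′ (2 ℕ.+ m ℕ.* 5) ≡ false) →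
        (∀ m → good′ (3 ℕ.+ m ℕ.* 5) ≡ false) → (∀ m → good′ (4 ℕ.+ m ℕ.* 5) ≡ true) →
        (∀ m → good′ (5 ℕ.+ m ℕ.* 5) ≡ true) →
        ∀ k → n ℕ.≤ suc k → A k 2 ≈ partProduct good (suc k)
      A≈partProduct₁ good good′ g≡false g≡g′ g₁ g₂ g₃ g₄ g₅ k n≤1+k = cancel-1-q (begin
        (1# - q) * A k 2
          ≈⟨ First.A≈product k n≤1+k ⟩
        Π (triple (q ^ 1) (q ^ 4)) N
          ≈⟨ partProduct-blocks good′ block≈ n≤1+k ⟨
        partProduct good′ (suc k)
          ≈⟨ Π-front _ k ⟩
        factor (good′ 1) 1 * Π (λ j → factor (good′ (2 ℕ.+ j)) (2 ℕ.+ j)) k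
          ≡⟨ ≡.cong (λ g → factor g 1 * Π (λ j → factor (good′ (2 ℕ.+ j)) (2 ℕ.+ j)) k) (g₁ 0) ⟩
        (1# - q * 1#) * Π (λ j → factor (good′ (2 ℕ.+ j)) (2 ℕ.+ j)) k
          ≈⟨ *-congˡ (Π-cong k λ i _ → reflexive (≡.cong (λ g → factor g (2 ℕ.+ i)) (≡.sym (g≡g′ i)))) ⟩
        (1# - q * 1#) * Π (λ j → factor (good (2 ℕ.+ j)) (2 ℕ.+ j)) k
          ≈⟨ solve 2 (λ q x → (:1 :- q :* :1) :* x := (:1 :- q) :* (:1 :* x)) refl _ _ ⟩
        (1# - q) * (1# * Π (λ j → factor (good (2 ℕ.+ j)) (2 ℕ.+ j)) k)
          ≡⟨ ≡.cong (λ g → (1# - q) * (factor g 1 * Π (λ j → factor (good (2 ℕ.+ j)) (2 ℕ.+ j)) k)) (≡.sym g≡false) ⟩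
        (1# - q) * (factor (good 1) 1 * Π (λ j → factor (good (2 ℕ.+ j)) (2 ℕ.+ j)) k)
          ≈⟨ *-congˡ (Π-front _ k) ⟨
        (1# - q) * partProduct good (suc k) ∎)
        where
        block≈ : ∀ m → block good′ m ≈ triple (q ^ 1) (q ^ 4) m
        block≈ m rewrite g₁ m | g₂ m | g₃ m | g₄ m | g₅ m = begin
          1# * (1# - q ^ (1 ℕ.+ m ℕ.* 5)) * 1# * 1# * (1# - q ^ (4 ℕ.+ m ℕ.* 5)) * (1# - q ^ (5 ℕ.+ m ℕ.* 5))
            ≈⟨ *-cong (*-cong (*-congʳ (*-congʳ (*-congˡ (1-q^≈ 1 m)))) (1-q^≈ 4 m)) (1-q^≈ 5 m) ⟩
          1# * (1# - q ^ 1 * Q ^ m) * 1# * 1# * (1# - q ^ 4 * Q ^ m) * (1# - Q ^ suc m)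
            ≈⟨ solve 3 (λ x y z → :1 :* x :* :1 :* :1 :* y :* z := x :* y :* z) refl _ _ _ ⟩
          triple (q ^ 1) (q ^ 4) m ∎

open ≡
open import Data.Fin using (Fin; zero; suc)
open import Data.List.Relation.Unary.All using (All; []; _∷_)
open import Data.List.Relation.Unary.AllPairs using ([]; _∷_)
open import Data.List.Relation.Unary.Any using (Any; here; there)
open Partitions
open Signature
open import Data.Integer using (-_) renaming (_+_ to _+ℤ_; _*_ to _*ℤ_)

-- Neighbors, covers and multiplicities.

mult≥1 : ∀ {v l} → v ∈ l → 1 ≤ mult v l
mult≥1 {v} v∈l = ∈-length (∈-filter⁺ (ℕₚ._≟ v) v∈l refl)

mult≥1⇒∈ : ∀ {v} l → 1 ≤ mult v l → v ∈ l
mult≥1⇒∈ {v} l 1≤m with filter (ℕₚ._≟ v) l in eq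
... | x ∷ _ with ∈-filter⁻ (ℕₚ._≟ v) {xs = l} (subst (x ∈_) (sym eq) (here refl))
... | x∈l , refl = x∈l

∈⇒index : ∀ {v : ℕ} {l} → v ∈ l → ∃ λ j → lookup l j ≡ v
∈⇒index v∈l = Any.index v∈l , sym (Any.lookup-index v∈l)

second-index : ∀ l (j : Fin (length l)) → 2 ≤ mult (lookup l j) l → ∃ λ k → k ≢ j × lookup l k ≡ lookup l j
second-index (x ∷ l) zero 2≤m =
  let k , eq = ∈⇒index (mult≥1⇒∈ l (ℕ.s≤s⁻¹ (subst (2 ≤_) (mult-same x l) 2≤m))) in suc k , (λ ()) , eq
second-index (x ∷ l) (suc j) 2≤m with x ℕₚ.≟ lookup l j
... | yes x≡ = zero , (λ ()) , x≡
... | no  x≢ = let k , k≢j , eq = second-index l j (subst (2 ≤_) (mult-other l x≢) 2≤m)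
               in suc k , k≢j ∘ Fin.suc-injective , eq

data GraphEdge (l : List ℕ) : Edge → Set where
  isRung : ∀ h → 1 ≤ mult h l → 1 ≤ mult (suc h) l → GraphEdge l (rung h)
  isLoop : ∀ h → 2 ≤ mult h l → GraphEdge l (loop h)

edges-GraphEdge : ∀ l → All (GraphEdge l) (edges l)
edges-GraphEdge l = All.concat⁺ (All.map⁺ (All.universal at (values l)))
  where
  rungs : ∀ v {c c′} → c ≡ mult v l → c′ ≡ mult (suc v) l → All (GraphEdge l) (rungsOf c c′ v)
  rungs v {zero}           _ _ = []
  rungs v {suc _} {zero}   _ _ = []
  rungs v {suc _} {suc _}  e e′ = isRung v (subst (1 ≤_) e (s≤s z≤n)) (subst (1 ≤_) e′ (s≤s z≤n)) ∷ []
  loops : ∀ v {c} → c ≡ mult v l → All (GraphEdge l) (loopsOf c v)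
  loops v {0}           _ = []
  loops v {1}           _ = []
  loops v {suc (suc _)} e = isLoop v (subst (2 ≤_) e (s≤s (s≤s z≤n))) ∷ []
  at : ∀ v → All (GraphEdge l) (edgesAt l v)
  at v = subst (All (GraphEdge l)) (sym (edgesAt≡ l v)) (All.++⁺ (rungs v refl refl) (loops v refl))

vertex-∈ : ∀ {v l} → 1 ≤ v → v ∈ l → (v , X) ∈ vertices l
vertex-∈ {suc v} {l} _ v∈l = ∈-concatMap⁺ (verticesAt l) {xs = values l}
  (lose (∈-map⁺ suc (∈-upTo⁺ (All.lookup (parts≤sum l) v∈l)))
        (subst ((suc v , X) ∈_) (sym (verticesAt≡ l (suc v))) (first (mult≥1 v∈l))))
  where
  first : ∀ {c} → 1 ≤ c → (suc v , X) ∈ verticesOf c (suc v)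
  first {1}           _ = here refl
  first {suc (suc _)} _ = here refl

-- The edge that covers x_v points at the required part: a rung leads to v - 1 or v + 1, a loop to
-- the second copy of v. Contrapositively `δ` is 0 where condition (1) fails, so the summation may
-- ignore that condition.
covers⇒neighbor : ∀ {l S} → All (1 ≤_) l → All (GraphEdge l) S → Covers S (vertices l) → NeighborCond l
covers⇒neighbor {l} {S} pos inGraph covers j =
  neighbor (All.lookupAny inGraph covered)
  where
  v = lookup l j
  covered : Any (λ e → Incident e (v , X)) S
  covered = All.lookup covers (vertex-∈ {v} {l} (All.lookup pos (∈-lookup j)) (∈-lookup {xs = l} j))
  via : ∀ {u} → u ≢ v → ∣ u - v ∣ ≤ 1 → 1 ≤ mult u l → ∃ λ k → k ≢ j × ∣ lookup l k - v ∣ ≤ 1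
  via u≢v near 1≤m with ∈⇒index (mult≥1⇒∈ l 1≤m)
  ... | k , refl = k , (λ { refl → u≢v refl }) , near
  neighbor : ∀ {e} → GraphEdge l e × Incident e (v , X) → ∃ λ k → k ≢ j × ∣ lookup l k - v ∣ ≤ 1
  neighbor (isRung h m m′ , inj₁ eq) = via (λ h≡v → ℕₚ.1+n≢n (trans (cong proj₁ eq) (sym h≡v)))
    (subst (λ u → ∣ h - u ∣ ≤ 1) (cong proj₁ eq) (ℕₚ.≤-reflexive (trans (ℕₚ.m≤n⇒∣m-n∣≡n∸m (ℕₚ.n≤1+n h)) (ℕₚ.m+n∸n≡m 1 h)))) m
  neighbor (isRung h m m′ , inj₂ eq) = via (λ h≡v → ℕₚ.1+n≢n (trans h≡v (sym (cong proj₁ eq))))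
    (subst (λ u → ∣ suc h - u ∣ ≤ 1) (cong proj₁ eq) (ℕₚ.≤-reflexive (trans (ℕₚ.m≤n⇒∣n-m∣≡n∸m (ℕₚ.n≤1+n h)) (ℕₚ.m+n∸n≡m 1 h)))) m′
  neighbor (isLoop h m , inj₁ refl) with second-index l j m
  ... | k , k≢j , eq = k , k≢j , ℕₚ.≤-trans (ℕₚ.≤-reflexive (ℕₚ.m≡n⇒∣m-n∣≡0 eq)) z≤n

¬neighbor⇒δ≡0 : ∀ {l} → All (1 ≤_) l → ¬ NeighborCond l → δ l ≡ + 0
¬neighbor⇒δ≡0 {l} pos ¬nc = coverSum-none (edges l) (vertices l)
  (All.map (λ inGraph covers → ¬nc (covers⇒neighbor pos inGraph covers)) (subsets-All (edges-GraphEdge l)))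

mult-toParts-≤ : ∀ {m} h cs v → All (_≤ m) cs → mult v (toParts h cs) ≤ m
mult-toParts-≤ h []       v _          = z≤n
mult-toParts-≤ h (c ∷ cs) v (c≤ ∷ cs≤) with v ℕₚ.≟ h
... | yes refl = subst (_≤ _) (sym (mult-toParts-here h c cs)) c≤
... | no  v≢h  = subst (_≤ _) (sym (mult-toParts-≢ c cs v≢h)) (mult-toParts-≤ (suc h) cs v cs≤)

toParts-unique : ∀ h cs → All (_≤ 1) cs → Unique (toParts h cs)
toParts-unique h []       []          = []
toParts-unique h (0 ∷ cs) (_ ∷ cs≤1)  = subst Unique (sym (List.++-identityʳ _)) (toParts-unique (suc h) cs cs≤1)
toParts-unique h (1 ∷ cs) (_ ∷ cs≤1)  = AllPairs.++⁺ (toParts-unique (suc h) cs cs≤1) ([] ∷ [])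
  (All.map (λ h<v → ℕₚ.>⇒≢ h<v ∷ []) (toParts-≥ (suc h) cs))
toParts-unique h (suc (suc _) ∷ cs) (s≤s () ∷ _)

∈012⇒≤2 : ∀ {c} → c ∈ 0 ∷ 1 ∷ 2 ∷ [] → c ≤ 2
∈012⇒≤2 (here refl)                 = z≤n
∈012⇒≤2 (there (here refl))         = s≤s z≤n
∈012⇒≤2 (there (there (here refl))) = ℕₚ.≤-refl

≤2⇒∈012 : ∀ {c} → c ≤ 2 → c ∈ 0 ∷ 1 ∷ 2 ∷ []
≤2⇒∈012 {0} _ = here refl
≤2⇒∈012 {1} _ = there (here refl)
≤2⇒∈012 {2} _ = there (there (here refl))
≤2⇒∈012 {suc (suc (suc _))} (s≤s (s≤s ()))

∈01⇒≤1 : ∀ {c} → c ∈ 0 ∷ 1 ∷ [] → c ≤ 1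
∈01⇒≤1 (here refl)         = z≤n
∈01⇒≤1 (there (here refl)) = ℕₚ.≤-refl

≤1⇒∈01 : ∀ {c} → c ≤ 1 → c ∈ 0 ∷ 1 ∷ []
≤1⇒∈01 {0} _ = here refl
≤1⇒∈01 {1} _ = there (here refl)
≤1⇒∈01 {suc (suc _)} (s≤s ())

-- Multiplicities of values that do not occur are 0, so bounds at the parts suffice.
mult-bound : ∀ {m} l → (∀ j → mult (lookup l j) l ≤ m) → ∀ v → mult v l ≤ m
mult-bound {m} l bound v with mult v l in eq
... | zero  = z≤n
... | suc c with ∈⇒index (mult≥1⇒∈ l (subst (1 ≤_) (sym eq) (s≤s z≤n)))
...   | j , refl = subst (_≤ m) eq (bound j)

distinct⇒mult≤1 : ∀ l → Distinct l → ∀ j → mult (lookup l j) l ≤ 1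
distinct⇒mult≤1 l distinct j with mult (lookup l j) l ≤? 1
... | yes ≤1 = ≤1
... | no  ≰1 = let k , k≢j , eq = second-index l j (ℕₚ.≰⇒> ≰1) in ⊥-elim (distinct k j k≢j eq)

unique⇒distinct : ∀ {l} → Unique l → Distinct l
unique⇒distinct (x≢l ∷ l!) zero    zero    0≢0 = ⊥-elim (0≢0 refl)
unique⇒distinct (x≢l ∷ l!) zero    (suc k) _   = All.lookup x≢l (∈-lookup k)
unique⇒distinct (x≢l ∷ l!) (suc j) zero    _   = All.lookup x≢l (∈-lookup j) ∘ sym
unique⇒distinct (x≢l ∷ l!) (suc j) (suc k) j≢k = unique⇒distinct l! j k (j≢k ∘ cong suc)

All-fromLookup : ∀ {P : ℕ → Set} {l} → (∀ j → P (lookup l j)) → All P l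
All-fromLookup {P} p = All.tabulate λ x∈l → subst P (sym (Any.lookup-index x∈l)) (p (Any.index x∈l))

Residue : ℕ → ℕ → Set
Residue i v = (v % 5 ≡ 0) ⊎ (v % 5 ≡ i % 5) ⊎ ((v ℕ.+ i) % 5 ≡ 0)

residue? : ∀ i → Decidable (Residue i)
residue? i v = (v % 5 ℕₚ.≟ 0) ⊎-dec (v % 5 ℕₚ.≟ i % 5) ⊎-dec ((v ℕ.+ i) % 5 ℕₚ.≟ 0)

Good : ℕ → ℕ → Set
Good i v = 3 ∸ i ≤ v × Residue i v

good? : ∀ i → Decidable (Good i)
good? i v = (3 ∸ i ≤? v) ×-dec residue? i v

module _ {P : ℕ → Set} (P? : Decidable P) where

  ρ-good : ∀ h cs → All (_≤ 1) cs → All P (toParts h cs) → ρ (does ∘ P?) h cs ≡ negOnePow (length (toParts h cs))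
  ρ-good h []       _          _    = refl
  ρ-good h (0 ∷ cs) (_ ∷ cs≤1) good =
    trans (ρ-good (suc h) cs cs≤1 (All.++⁻ˡ (toParts (suc h) cs) good)) (cong (negOnePow ∘ length) (sym (List.++-identityʳ (toParts (suc h) cs))))
  ρ-good h (1 ∷ cs) (_ ∷ cs≤1) good with All.++⁻ (toParts (suc h) cs) good
  ... | good′ , Ph ∷ [] = begin
    (if does (P? h) then - ρ (does ∘ P?) (suc h) cs else + 0) ≡⟨ cong (if_then - ρ (does ∘ P?) (suc h) cs else + 0) (dec-true (P? h) Ph) ⟩
    - ρ (does ∘ P?) (suc h) cs                       ≡⟨ cong -_ (ρ-good (suc h) cs cs≤1 good′) ⟩
    negOnePow (suc (length (toParts (suc h) cs)))    ≡⟨ cong negOnePow (trans (List.length-++ (toParts (suc h) cs)) (ℕₚ.+-comm _ 1)) ⟨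
    negOnePow (length (toParts (suc h) cs ++ h ∷ [])) ∎
    where open ≡-Reasoning
  ρ-good h (suc (suc _) ∷ cs) (s≤s () ∷ _) _

  ρ-bad : ∀ h cs → All (_≤ 1) cs → ¬ All P (toParts h cs) → ρ (does ∘ P?) h cs ≡ + 0
  ρ-bad h []       _          bad = ⊥-elim (bad [])
  ρ-bad h (0 ∷ cs) (_ ∷ cs≤1) bad = ρ-bad (suc h) cs cs≤1 (λ good → bad (All.++⁺ good []))
  ρ-bad h (1 ∷ cs) (_ ∷ cs≤1) bad with P? h
  ... | yes Ph = cong -_ (ρ-bad (suc h) cs cs≤1 (λ good → bad (All.++⁺ good (Ph ∷ []))))
  ... | no  _  = refl
  ρ-bad h (suc (suc _) ∷ cs) (s≤s () ∷ _) _

open PowerSeries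

monomial-same : ∀ c m → monomial c m m ≡ c
monomial-same c zero    = refl
monomial-same c (suc m) = monomial-same c m

monomial-other : ∀ c {m k} → m ≢ k → monomial c m k ≡ + 0
monomial-other c {zero}  {zero}  m≢k = ⊥-elim (m≢k refl)
monomial-other c {zero}  {suc k} m≢k = refl
monomial-other c {suc m} {zero}  m≢k = refl
monomial-other c {suc m} {suc k} m≢k = monomial-other c (m≢k ∘ cong suc)

-- Sums over partitions as coefficients of q^n.

module Coefficients (n : ℕ) where

  open CommutativeRing (truncated n) using (semiring)
  open import Algebra.Properties.Semiring.Exp semiring using (_^_)

  q : Series
  q = monomial (+ 1) 1

  q^ : ∀ m k → (q ^ m) k ≡ monomial (+ 1) m k
  q^ zero    k = refl
  q^ (suc m) k = trans (⊛-congʳ k) (monomial-⊛ (+ 1) 1 (+ 1) m k)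
    where
    ⊛-congʳ : ∀ k → (q ⊛ (q ^ m)) k ≡ (q ⊛ monomial (+ 1) m) k
    ⊛-congʳ k = ⊛-cong k {q} {q} (λ _ _ → refl) (λ j _ → q^ m j) k ℕₚ.≤-refl

  q-nilpotent : Eq n (q ^ suc n) (constant (+ 0))
  q-nilpotent = mkEq λ k k≤n → trans (q^ (suc n) k) (trans (monomial-other (+ 1) (ℕₚ.>⇒≢ (s≤s k≤n))) (sym (constant0 k)))

  open QSeries (truncated n) (scalars n) public
  open RogersSelberg q public
  open Truncated n q-nilpotent public

  scaled-power : ∀ c m k → (constant c ⊛ (q ^ m)) k ≡ monomial c m k
  scaled-power c m k = begin
    (constant c ⊛ (q ^ m)) k          ≡⟨ constant-⊛ c (q ^ m) k ⟩
    c *ℤ (q ^ m) k                    ≡⟨ cong (c *ℤ_) (q^ m k) ⟩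
    c *ℤ monomial (+ 1) m k           ≡⟨ constant-⊛ c (monomial (+ 1) m) k ⟨
    (constant c ⊛ monomial (+ 1) m) k ≡⟨ monomial-⊛ c 0 (+ 1) m k ⟩
    monomial (c *ℤ + 1) m k           ≡⟨ cong (λ c → monomial c m k) (ℤₚ.*-identityʳ c) ⟩
    monomial c m k                    ∎
    where open ≡-Reasoning

  module _ {P : List ℕ → Set} (P? : Decidable P) {xs : List ℕ} (xs! : Unique xs)
           (mults∈xs : ∀ l → P l → ∀ v → mult v l ∈ xs)
           (w W : List ℕ → ℤ)
           (yes-weight : ∀ cs → All (_∈ xs) cs → length cs ≡ n → sum (toParts 1 cs) ≡ n → P (toParts 1 cs) → W cs ≡ w (toParts 1 cs))
           (no-weight : ∀ cs → All (_∈ xs) cs → length cs ≡ n → sum (toParts 1 cs) ≡ n → ¬ P (toParts 1 cs) → W cs ≡ + 0)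
           where

    private
      S? = Selected? P? n

      selected-sum : ∀ L → All (λ cs → All (_∈ xs) cs × length cs ≡ n) L →
        sumℤ (map w (map (toParts 1) (filter S? L))) ≡ weigh W (partWeight 1) L n
      selected-sum [] [] = sym (constant0 n)
      selected-sum (cs ∷ L) ((cs⊆ , len) ∷ hL) = step (sum (toParts 1 cs) ℕₚ.≟ n) (P? (toParts 1 cs))
        where
        rest = weigh W (partWeight 1) L n

        head : ℤ
        head = (constant (W cs) ⊛ (q ^ partWeight 1 cs)) n

        head≡W : sum (toParts 1 cs) ≡ n → head ≡ W cs
        head≡W s≡n = trans (scaled-power (W cs) (partWeight 1 cs) n)
          (trans (cong (λ m → monomial (W cs) m n) s≡n) (monomial-same (W cs) n))

        reject : ¬ (sum (toParts 1 cs) ≡ n × P (toParts 1 cs)) → head ≡ + 0 →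
                 sumℤ (map w (map (toParts 1) (filter S? (cs ∷ L)))) ≡ head +ℤ rest
        reject ¬s head≡0 = begin
          sumℤ (map w (map (toParts 1) (filter S? (cs ∷ L)))) ≡⟨ cong (sumℤ ∘ map w ∘ map (toParts 1)) (List.filter-reject S? {cs} {L} ¬s) ⟩
          sumℤ (map w (map (toParts 1) (filter S? L)))        ≡⟨ selected-sum L hL ⟩
          rest                                                ≡⟨ ℤₚ.+-identityˡ rest ⟨
          + 0 +ℤ rest                                         ≡⟨ cong (_+ℤ rest) head≡0 ⟨
          head +ℤ rest                                        ∎
          where open ≡-Reasoning

        step : Dec (sum (toParts 1 cs) ≡ n) → Dec (P (toParts 1 cs)) →
               sumℤ (map w (map (toParts 1) (filter S? (cs ∷ L)))) ≡ head +ℤ rest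
        step (yes s≡n) (yes p) = trans
          (cong (sumℤ ∘ map w ∘ map (toParts 1)) (List.filter-accept S? {cs} {L} (s≡n , p)))
          (cong₂ _+ℤ_ (sym (trans (head≡W s≡n) (yes-weight cs cs⊆ len s≡n p))) (selected-sum L hL))
        step (yes s≡n) (no ¬p) = reject (¬p ∘ proj₂) (trans (head≡W s≡n) (no-weight cs cs⊆ len s≡n ¬p))
        step (no s≢n)  _       = reject (s≢n ∘ proj₁)
          (trans (scaled-power (W cs) (partWeight 1 cs) n) (monomial-other (W cs) s≢n))

    -- Lists with another sum do not reach the coefficient of q^n, and lists that fail `P` have
    -- weight 0, so the unfiltered generating function already computes the filtered sum.
    sum≡coefficient : sumℤ (map w (filter P? (partitionsOf n))) ≡ gf xs W n 1 n
    sum≡coefficient = trans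
      (sumℤ-↭ (Perm.map⁺ w (partitions↭toParts P? n xs! mults∈xs)))
      (selected-sum (listsOfLength n xs) (All.tabulate (∈-listsOfLength⁻ n)))

012! : Unique (0 ∷ 1 ∷ 2 ∷ [])
012! = ((λ ()) ∷ (λ ()) ∷ []) ∷ ((λ ()) ∷ []) ∷ [] ∷ []

01! : Unique (0 ∷ 1 ∷ [])
01! = ((λ ()) ∷ []) ∷ [] ∷ []

neighborly-mults : ∀ i l → IsNeighborly i l → ∀ v → mult v l ∈ 0 ∷ 1 ∷ 2 ∷ []
neighborly-mults i l (_ , multCond , _) v = ≤2⇒∈012 (mult-bound l multCond v)

-- Multiplicities from 0, 1, 2 settle condition (2) and `lower` settles (3), so only the neighbor
-- condition can fail.
¬neighborly⇒δ≡0 : ∀ i cs → All (_∈ 0 ∷ 1 ∷ 2 ∷ []) cs → LowerCond i (toParts 1 cs) →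
                  ¬ IsNeighborly i (toParts 1 cs) → δ (toParts 1 cs) ≡ + 0
¬neighborly⇒δ≡0 i cs cs⊆ lower ¬neighborly = ¬neighbor⇒δ≡0 (toParts-≥ 1 cs)
  λ neighbor → ¬neighborly (neighbor , (λ j → mult-toParts-≤ 1 cs _ (All.map ∈012⇒≤2 cs⊆)) , lower)

lookup-≥ : ∀ {m l} → All (m ≤_) l → ∀ j → m ≤ lookup l j
lookup-≥ {l = l} m≤l j = All.lookup m≤l (∈-lookup {xs = l} j)

N₂-coefficient : ∀ n → let open Coefficients n in sumℤ (map δ (Nset 2 n)) ≡ gf₂ τ n 1 n
N₂-coefficient n = Coefficients.sum≡coefficient n (isNeighborly? 2) 012! (neighborly-mults 2) δ τ
  (λ cs _ len s≡n _ → sym (δ≡τ cs (trans s≡n (sym len))))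
  (λ cs cs⊆ len s≡n ¬p → trans (sym (δ≡τ cs (trans s≡n (sym len))))
    (¬neighborly⇒δ≡0 2 cs cs⊆ (lookup-≥ (toParts-≥ 1 cs)) ¬p))

N₁-coefficient : ∀ n → let open Coefficients n in sumℤ (map δ (Nset 1 n)) ≡ gf₂ τ₂ n 1 n
N₁-coefficient n = Coefficients.sum≡coefficient n (isNeighborly? 1) 012! (neighborly-mults 1) δ τ₂ yes-weight no-weight
  where
  no-ones : ∀ c cs → ¬ LowerCond 1 (toParts 1 (suc c ∷ cs))
  no-ones c cs lower with ∈⇒index (Any.++⁺ʳ (toParts 2 cs) (here {x = 1} {xs = replicate c 1} refl))
  ... | j , eq = ℕₚ.<⇒≱ (lower j) (ℕₚ.≤-reflexive eq)
  yes-weight : ∀ cs → All (_∈ 0 ∷ 1 ∷ 2 ∷ []) cs → length cs ≡ n → sum (toParts 1 cs) ≡ n →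
               IsNeighborly 1 (toParts 1 cs) → τ₂ cs ≡ δ (toParts 1 cs)
  yes-weight []           _ len s≡n _ = refl
  yes-weight (0 ∷ cs)     _ len s≡n _ = sym (δ≡τ (0 ∷ cs) (trans s≡n (sym len)))
  yes-weight (suc c ∷ cs) _ len s≡n (_ , _ , lower) = ⊥-elim (no-ones c cs lower)
  no-weight : ∀ cs → All (_∈ 0 ∷ 1 ∷ 2 ∷ []) cs → length cs ≡ n → sum (toParts 1 cs) ≡ n →
              ¬ IsNeighborly 1 (toParts 1 cs) → τ₂ cs ≡ + 0
  -- The empty list is neighborly vacuously, so this case is contradictory, although `τ₂ []` is 1.
  no-weight []           _   len s≡n ¬p = ⊥-elim (¬p ((λ ()) , (λ ()) , (λ ())))
  no-weight (0 ∷ cs)     cs⊆ len s≡n ¬p = trans (sym (δ≡τ (0 ∷ cs) (trans s≡n (sym len))))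
    (¬neighborly⇒δ≡0 1 (0 ∷ cs) cs⊆ (lookup-≥ (All.++⁺ (toParts-≥ 2 cs) [])) ¬p)
  no-weight (suc c ∷ cs) _   len s≡n ¬p = refl

R-coefficient : ∀ i n → let open Coefficients n in
  sumℤ (map (λ l → negOnePow (size l)) (Rset i n)) ≡ gf₁ (ρ (does ∘ good? i) 1) n 1 n
R-coefficient i n = Coefficients.sum≡coefficient n (isR? i) 01!
  (λ l (distinct , _) v → ≤1⇒∈01 (mult-bound l (distinct⇒mult≤1 l distinct) v))
  (negOnePow ∘ length) (ρ (does ∘ good? i) 1)
  (λ cs cs⊆ _ _ (_ , lower , mod) → ρ-good (good? i) 1 cs (All.map ∈01⇒≤1 cs⊆)
    (All-fromLookup λ j → lower j , mod j))
  (λ cs cs⊆ _ _ ¬p → ρ-bad (good? i) 1 cs (All.map ∈01⇒≤1 cs⊆)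
    λ good → ¬p (unique⇒distinct (toParts-unique 1 cs (All.map ∈01⇒≤1 cs⊆))
                , (λ j → proj₁ (All.lookup good (∈-lookup j))) , (λ j → proj₂ (All.lookup good (∈-lookup j)))))

-- Residues modulo 5 and the two values of i.

residue-shift : ∀ i r m → Residue i (r ℕ.+ m ℕ.* 5) → Residue i r
residue-shift i r m (inj₁ e)        = inj₁ (trans (sym ([m+kn]%n≡m%n r m 5)) e)
residue-shift i r m (inj₂ (inj₁ e)) = inj₂ (inj₁ (trans (sym ([m+kn]%n≡m%n r m 5)) e))
residue-shift i r m (inj₂ (inj₂ e)) = inj₂ (inj₂ (trans (sym ([m+kn]%n≡m%n (r ℕ.+ i) m 5)) (trans (cong (_% 5) (swap r i m)) e)))
  where
  swap : ∀ r i m → r ℕ.+ i ℕ.+ m ℕ.* 5 ≡ r ℕ.+ m ℕ.* 5 ℕ.+ i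
  swap r i m = trans (ℕₚ.+-assoc r i _) (trans (cong (r ℕ.+_) (ℕₚ.+-comm i _)) (sym (ℕₚ.+-assoc r _ i)))

residue-unshift : ∀ i r m → Residue i r → Residue i (r ℕ.+ m ℕ.* 5)
residue-unshift i r m (inj₁ e)        = inj₁ (trans ([m+kn]%n≡m%n r m 5) e)
residue-unshift i r m (inj₂ (inj₁ e)) = inj₂ (inj₁ (trans ([m+kn]%n≡m%n r m 5) e))
residue-unshift i r m (inj₂ (inj₂ e)) = inj₂ (inj₂ (trans (cong (_% 5) (swap r i m)) (trans ([m+kn]%n≡m%n (r ℕ.+ i) m 5) e)))
  where
  swap : ∀ r i m → r ℕ.+ m ℕ.* 5 ℕ.+ i ≡ r ℕ.+ i ℕ.+ m ℕ.* 5
  swap r i m = trans (ℕₚ.+-assoc r _ i) (trans (cong (r ℕ.+_) (ℕₚ.+-comm _ i)) (sym (ℕₚ.+-assoc r i _)))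

residue-true : ∀ i r m → Residue i r → does (residue? i (r ℕ.+ m ℕ.* 5)) ≡ true
residue-true i r m res = dec-true (residue? i (r ℕ.+ m ℕ.* 5)) (residue-unshift i r m res)

residue-false : ∀ i r m → ¬ Residue i r → does (residue? i (r ℕ.+ m ℕ.* 5)) ≡ false
residue-false i r m ¬res = dec-false (residue? i (r ℕ.+ m ℕ.* 5)) (¬res ∘ residue-shift i r m)

N₂≡R₂ : ∀ n → sumℤ (map δ (Nset 2 n)) ≡ sumℤ (map (λ l → negOnePow (size l)) (Rset 2 n))
N₂≡R₂ n = begin
  sumℤ (map δ (Nset 2 n))                           ≡⟨ N₂-coefficient n ⟩
  gf₂ τ n 1 n                                       ≡⟨ coeff (gf-τ≈A n 1) n ℕₚ.≤-refl ⟩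
  A n 1 n                                           ≡⟨ coeff product n ℕₚ.≤-refl ⟩
  partProduct good n n                              ≡⟨ coeff (gf-ρ good n 1) n ℕₚ.≤-refl ⟨
  gf₁ (ρ good 1) n 1 n                              ≡⟨ R-coefficient 2 n ⟨
  sumℤ (map (λ l → negOnePow (size l)) (Rset 2 n))  ∎
  where
  open ≡-Reasoning
  open Coefficients n
  good = does ∘ good? 2
  product : Eq n (A n 1) (partProduct good n)
  product = A≈partProduct₂ good
    -- All arguments are successors, so the bound 1 ≤ v computes to true and only the residue test
    -- remains.
    (λ m → residue-false 2 1 m λ { (inj₁ ()) ; (inj₂ (inj₁ ())) ; (inj₂ (inj₂ ())) })
    (λ m → residue-true 2 2 m (inj₂ (inj₁ refl)))
    (λ m → residue-true 2 3 m (inj₂ (inj₂ refl)))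
    (λ m → residue-false 2 4 m λ { (inj₁ ()) ; (inj₂ (inj₁ ())) ; (inj₂ (inj₂ ())) })
    (λ m → residue-true 2 5 m (inj₁ refl))
    n ℕₚ.≤-refl

-- The part value 1 occupies one of the n slots and `τ₂` forces its multiplicity to be 0. The other
-- k slots begin at the value 2, whence `A k 2`.
N₁≡R₁ : ∀ k → sumℤ (map δ (Nset 1 (suc k))) ≡ sumℤ (map (λ l → negOnePow (size l)) (Rset 1 (suc k)))
N₁≡R₁ k = begin
  sumℤ (map δ (Nset 1 n))                           ≡⟨ N₁-coefficient n ⟩
  gf₂ τ₂ n 1 n                                      ≡⟨ coeff (gf-τ₂≈A k) n ℕₚ.≤-refl ⟩
  A k 2 n                                           ≡⟨ coeff product n ℕₚ.≤-refl ⟩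
  partProduct good n n                              ≡⟨ coeff (gf-ρ good n 1) n ℕₚ.≤-refl ⟨
  gf₁ (ρ good 1) n 1 n                              ≡⟨ R-coefficient 1 n ⟨
  sumℤ (map (λ l → negOnePow (size l)) (Rset 1 n))  ∎
  where
  open ≡-Reasoning
  n = suc k
  open Coefficients n
  good = does ∘ good? 1
  product : Eq n (A k 2) (partProduct good n)
  -- The bound 2 ≤ v fails at 1 and holds from 2 on, both by computation.
  product = A≈partProduct₁ good (does ∘ residue? 1) refl (λ v → refl)
    (λ m → residue-true 1 1 m (inj₂ (inj₁ refl)))
    (λ m → residue-false 1 2 m λ { (inj₁ ()) ; (inj₂ (inj₁ ())) ; (inj₂ (inj₂ ())) })
    (λ m → residue-false 1 3 m λ { (inj₁ ()) ; (inj₂ (inj₁ ())) ; (inj₂ (inj₂ ())) })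
    (λ m → residue-true 1 4 m (inj₂ (inj₂ refl)))
    (λ m → residue-true 1 5 m (inj₁ refl))
    k ℕₚ.≤-refl

theorem2 : (i n : ℕ) → (i ≡ 1 ⊎ i ≡ 2) → 1 ≤ n →
    sumℤ (map δ (Nset i n)) ≡ sumℤ (map (λ λ′ → negOnePow (size λ′)) (Rset i n))
theorem2 _ (suc k) (inj₁ refl) _ = N₁≡R₁ k
theorem2 _ n       (inj₂ refl) _ = N₂≡R₂ n
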